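{- Let $G$ be a finite $r$-uniform hypergraph with maximum degree $\Delta$, and let $\mathcal{E}=\{E_1,\ldots,E_n\}$ be a partition of its edge set $E(G)$ with $|E_i|\ge r\Delta+1$ for all $i$. Then $\mathbf{RG}(\mathcal{M}(G),\mathcal{E})$ is connected.
   Context: The matching complex $\mathcal{M}(G)$ is the complex on ground set $E(G)$ whose simplices are the matchings (sets of pairwise disjoint edges). A full rainbow matching of $(G,\mathcal{E})$ is a matching containing exactly one edge from each $E_i$. $\mathbf{RG}(\mathcal{M}(G),\mathcal{E})$ is the graph on full rainbow matchings, two being adjacent if their union is a matching of size $n+1$. -}

module Defs where

open import Data.Fin using (Fin)
open import Data.Fin.Subset using (Subset; _∈_; _⊆_; _∩_; _∪_; ∣_∣; Empty; Nonempty; ⊥)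
open import Data.Fin.Subset.Properties using (_∈?_; ∉⊥)
open import Data.List using (length; filter; map; allFin)
open import Data.List.Extrema.Nat using (max)
open import Data.Nat using (ℕ; suc)
open import Data.Product using (∃; _×_; _,_)
open import Data.Refinement using (Refinement; value)
open import Function.Definitions using (Injective)
open import Level using (0ℓ)
open import Relation.Binary.Core using (Rel)
open import Relation.Binary.Construct.Closure.ReflexiveTransitive using (Star)
open import Relation.Binary.PropositionalEquality using (_≡_; _≢_)
open import Relation.Nullary using (contradiction)

-- E(G) is a set of subsets of V(G), enumerated without repetition by
-- Fin #E; a set of edges is then a Subset #E.
record Hypergraph : Set where
  field
    #V             : ℕ
    #E             : ℕ
    edge           : Fin #E → Subset #V
    edge-injective : Injective _≡_ _≡_ edge

open Hypergraph public

Uniform : ℕ → Hypergraph → Set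
Uniform r G = ∀ e → ∣ edge G e ∣ ≡ r

degree : (G : Hypergraph) → Fin (#V G) → ℕ
degree G v = length (filter (λ e → v ∈? edge G e) (allFin (#E G)))

-- 0 when there are no vertices.
maxDegree : Hypergraph → ℕ
maxDegree G = max 0 (map (degree G) (allFin (#V G)))

record Partition (m n : ℕ) : Set where
  field
    part     : Fin n → Subset m
    nonempty : ∀ i → Nonempty (part i)
    disjoint : ∀ i j → i ≢ j → Empty (part i ∩ part j)
    cover    : ∀ x → ∃ λ i → x ∈ part i

open Partition public

record Complex (m : ℕ) : Set₁ where
  field
    Simplex     : Subset m → Set
    ∅-simplex   : Simplex ⊥
    down-closed : ∀ {σ τ} → σ ⊆ τ → Simplex τ → Simplex σ

open Complex public

IsMatching : (G : Hypergraph) → Subset (#E G) → Set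
IsMatching G M = ∀ e f → e ∈ M → f ∈ M → e ≢ f → Empty (edge G e ∩ edge G f)

matchingComplex : (G : Hypergraph) → Complex (#E G)
matchingComplex G = record
  { Simplex     = IsMatching G
  ; ∅-simplex   = λ e f e∈⊥ _ _ → contradiction e∈⊥ ∉⊥
  ; down-closed = λ σ⊆τ τ-matching e f e∈σ f∈σ → τ-matching e f (σ⊆τ e∈σ) (σ⊆τ f∈σ)
  }

IsFullRainbow : ∀ {m n} → Complex m → Partition m n → Subset m → Set
IsFullRainbow C P σ = Simplex C σ × (∀ i → ∣ σ ∩ part P i ∣ ≡ 1)

record Graph : Set₁ where
  field
    Vertex   : Set
    Adjacent : Rel Vertex 0ℓ

-- Vertices form a refinement type, so that two of them are equal as
-- soon as their underlying subsets are.
RG : ∀ {m n} → Complex m → Partition m n → Graph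
RG {m} {n} C P = record
  { Vertex   = Refinement (Subset m) (IsFullRainbow C P)
  ; Adjacent = λ s t → Simplex C (value s ∪ value t) × ∣ value s ∪ value t ∣ ≡ suc n
  }

-- A connected graph is required to be nonempty. RG has a symmetric
-- adjacency relation, so directed walks suffice.
Connected : Graph → Set
Connected Γ = Vertex × (∀ s t → Star Adjacent s t)
  where open Graph Γ

{-# OPTIONS --safe #-}
-- The proof is homological, with rational chains.
--
-- Vanishing.  Write ∂ A and δ A for the boundary and coboundary summing over
-- the elements of an edge set A.  They satisfy the anticommutation relation
-- ∂ A δ A + δ A ∂ A = |A|, so |∂ A y|² + |δ A y|² = |A| |y|².  Let y be harmonic
-- on the matchings of size at most k inside A.  Then δ A y lives on
-- non-matchings σ, and if two edges of σ meet at p, then δ A y agrees at σ with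
-- the coboundary along the edges at p of the part of y that covers p.  Hence
-- |A| |y|² = |δ A y|² ≤ Δ Σ_p |y_p|² ≤ Δ r k |y|², and y = 0 once |A| > Δ r k.
-- So cycles on such matchings bound inside A.
--
-- Existence.  Because every union of i classes has more than i r Δ edges (for
-- i > 0), an acyclic-carrier construction yields a chain map from the simplex
-- on the n colours to the matching complex; composing it with the colour map
-- is invertible on the top simplex, so a full rainbow matching occurs in it.
--
-- Connectedness.  The same construction, one dimension higher, gives a chain
-- homotopy between the chain maps of two full rainbow matchings s and t.  The
-- signed indicator of the component of s is a cocycle that kills everything
-- missing a colour, so it takes the same value on s and t.
module Submission where

open import Defs
import Algebra.Properties.CommutativeMonoid.Sum as Sum
open import Data.Bool as Bool using (true; false)
open import Data.Fin using (Fin; zero; suc) renaming (_≟_ to _≟ᶠ_)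
open import Data.Fin.Properties using (any?; all?)
open import Data.Fin.Subset using (Subset; Side; inside; outside; _∈_; _∉_; _⊆_; _∩_; _∪_; ∣_∣; Empty; Nonempty; ⊥; ⊤; ⁅_⁆)
open import Data.Fin.Subset.Properties
open import Data.Irrelevant using ([_])
open import Data.List as List using (List; []; _∷_; _++_)
open import Data.List.Extrema.Nat using (xs≤max)
open import Data.List.Membership.Propositional using () renaming (_∈_ to _∈ˡ_)
open import Data.List.Membership.Propositional.Properties using (∈-map⁺; ∈-++⁺ˡ; ∈-++⁺ʳ; ∈-filter⁺; ∈-allFin)
open import Data.List.Relation.Unary.All as All using (All; []; _∷_)
open import Data.List.Relation.Unary.All.Properties using (all-filter) renaming (map⁺ to All-map⁺; map⁻ to All-map⁻)
import Data.List.Relation.Unary.Any as Any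
open import Data.Nat as ℕ using (ℕ; zero; suc; z≤n; s≤s; _≥_)
import Data.Nat.Properties as ℕ
open import Data.Product using (∃; _×_; _,_; proj₁; proj₂)
open import Data.Rational using (ℚ; 0ℚ; 1ℚ; _+_; _*_; _-_; -_; _≤_; nonNegative; nonPositive; ≢-nonZero; 1/_)
open import Data.Rational.Properties as ℚ using (_≟_)
open import Data.Rational.Solver using (module +-*-Solver)
import Data.Refinement as Refinement
open import Data.Sum using (_⊎_; inj₁; inj₂)
open import Data.Vec using ([]; _∷_; lookup; _[_]≔_; here; there; tabulate)
open import Data.Vec.Properties using ([]=⇒lookup; lookup⇒[]=; []≔-updates; []≔-minimal; lookup∘tabulate; ≡-dec)
open import Function using (_∘_; case_of_)
open import Level using (0ℓ)
open import Relation.Binary using (Rel; DecidableEquality) renaming (Decidable to Decidable₂)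
open import Relation.Binary.Construct.Closure.ReflexiveTransitive using (Star; ε; _◅_; _◅◅_)
open import Relation.Binary.PropositionalEquality using (_≡_; _≢_; _≗_; refl; sym; trans; cong; cong₂; subst; module ≡-Reasoning)
open import Relation.Nullary using (¬_; yes; no; does; contradiction)
open import Relation.Nullary.Decidable using (map′; _×-dec_; _⊎-dec_; ¬?; dec-true; recompute)
open import Relation.Unary using (Decidable)

open +-*-Solver using (solve; _:=_; _:+_; _:*_; _:-_; :-_; con)
open Sum ℚ.+-0-commutativeMonoid using (sum-cong-≗) renaming (sum to Σ)

private
  variable
    m n : ℕ

-- Chains on the subsets of a finite set

Chain : ℕ → Set
Chain m = Subset m → ℚ

χ : Side → ℚ
χ inside  = 1ℚ
χ outside = 0ℚ

-- ∂ c and δ c are the sums over u ∈ c of the fermionic annihilation and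
-- creation operators; ∂ ⊤ is the simplicial boundary on all subsets.
∂ : Subset m → Chain m → Chain m
∂ []      f []            = 0ℚ
∂ (s ∷ c) f (outside ∷ τ) = χ s * f (inside ∷ τ) + ∂ c (f ∘ (outside ∷_)) τ
∂ (s ∷ c) f (inside  ∷ τ) = - ∂ c (f ∘ (inside ∷_)) τ

δ : Subset m → Chain m → Chain m
δ []      f []            = 0ℚ
δ (s ∷ c) f (outside ∷ τ) = δ c (f ∘ (outside ∷_)) τ
δ (s ∷ c) f (inside  ∷ τ) = χ s * f (outside ∷ τ) - δ c (f ∘ (inside ∷_)) τ

-- Chains are compared pointwise, so respect for `≗` is a field beside linearity. Evaluations of `∂`
-- and `δ` at a set, `∑`, and pairings with a fixed chain are all instances.
record Linear (ℓ : Chain m → ℚ) : Set where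
  field
    ℓ-cong : ∀ {f g} → f ≗ g → ℓ f ≡ ℓ g
    ℓ-lin  : ∀ a b f g → ℓ (λ σ → a * f σ + b * g σ) ≡ a * ℓ f + b * ℓ g

  ℓ-zero : ℓ (λ _ → 0ℚ) ≡ 0ℚ
  ℓ-zero = begin
    ℓ (λ _ → 0ℚ)                      ≡⟨ ℓ-cong (λ _ → refl) ⟩
    ℓ (λ _ → 0ℚ * 0ℚ + 0ℚ * 0ℚ)       ≡⟨ ℓ-lin 0ℚ 0ℚ _ _ ⟩
    0ℚ * ℓ _ + 0ℚ * ℓ _               ≡⟨ solve 1 (λ x → con 0ℚ :* x :+ con 0ℚ :* x := con 0ℚ) refl (ℓ (λ _ → 0ℚ)) ⟩
    0ℚ                                ∎
    where open ≡-Reasoning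

  ℓ-vanish : ∀ {f} → (∀ σ → f σ ≡ 0ℚ) → ℓ f ≡ 0ℚ
  ℓ-vanish f≗0 = trans (ℓ-cong f≗0) ℓ-zero

  ℓ-scale-add : ∀ a f g → ℓ (λ σ → a * f σ + g σ) ≡ a * ℓ f + ℓ g
  ℓ-scale-add a f g = begin
    ℓ (λ σ → a * f σ + g σ)        ≡⟨ ℓ-cong (λ σ → cong (a * f σ +_) (sym (ℚ.*-identityˡ (g σ)))) ⟩
    ℓ (λ σ → a * f σ + 1ℚ * g σ)   ≡⟨ ℓ-lin a 1ℚ f g ⟩
    a * ℓ f + 1ℚ * ℓ g             ≡⟨ cong (a * ℓ f +_) (ℚ.*-identityˡ (ℓ g)) ⟩
    a * ℓ f + ℓ g                  ∎
    where open ≡-Reasoning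

  ℓ-scale-sub : ∀ a f g → ℓ (λ σ → a * f σ - g σ) ≡ a * ℓ f - ℓ g
  ℓ-scale-sub a f g = begin
    ℓ (λ σ → a * f σ - g σ)
      ≡⟨ ℓ-cong (λ σ → solve 3 (λ a x y → a :* x :- y := a :* x :+ con (- 1ℚ) :* y) refl a (f σ) (g σ)) ⟩
    ℓ (λ σ → a * f σ + - 1ℚ * g σ) ≡⟨ ℓ-lin a (- 1ℚ) f g ⟩
    a * ℓ f + - 1ℚ * ℓ g
      ≡⟨ solve 3 (λ a x y → a :* x :+ con (- 1ℚ) :* y := a :* x :- y) refl a (ℓ f) (ℓ g) ⟩
    a * ℓ f - ℓ g                  ∎
    where open ≡-Reasoning

  ℓ-sub : ∀ f g → ℓ (λ σ → f σ - g σ) ≡ ℓ f - ℓ g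
  ℓ-sub f g = begin
    ℓ (λ σ → f σ - g σ)        ≡⟨ ℓ-cong (λ σ → cong (_- g σ) (sym (ℚ.*-identityˡ (f σ)))) ⟩
    ℓ (λ σ → 1ℚ * f σ - g σ)   ≡⟨ ℓ-scale-sub 1ℚ f g ⟩
    1ℚ * ℓ f - ℓ g             ≡⟨ cong (_- ℓ g) (ℚ.*-identityˡ (ℓ f)) ⟩
    ℓ f - ℓ g                  ∎
    where open ≡-Reasoning

  ℓ-neg : ∀ f → ℓ (λ σ → - f σ) ≡ - ℓ f
  ℓ-neg f = begin
    ℓ (λ σ → - f σ)        ≡⟨ ℓ-cong (λ σ → sym (ℚ.+-identityˡ (- f σ))) ⟩
    ℓ (λ σ → 0ℚ - f σ)     ≡⟨ ℓ-sub (λ _ → 0ℚ) f ⟩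
    ℓ (λ _ → 0ℚ) - ℓ f     ≡⟨ cong (_- ℓ f) ℓ-zero ⟩
    0ℚ - ℓ f               ≡⟨ ℚ.+-identityˡ (- ℓ f) ⟩
    - ℓ f                  ∎
    where open ≡-Reasoning

  ℓ-scale : ∀ a f → ℓ (λ σ → a * f σ) ≡ a * ℓ f
  ℓ-scale a f = begin
    ℓ (λ σ → a * f σ)             ≡⟨ ℓ-cong (λ σ → sym (ℚ.+-identityʳ (a * f σ))) ⟩
    ℓ (λ σ → a * f σ + 0ℚ)        ≡⟨ ℓ-scale-add a f (λ _ → 0ℚ) ⟩
    a * ℓ f + ℓ (λ _ → 0ℚ)        ≡⟨ cong (a * ℓ f +_) ℓ-zero ⟩
    a * ℓ f + 0ℚ                  ≡⟨ ℚ.+-identityʳ (a * ℓ f) ⟩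
    a * ℓ f                       ∎
    where open ≡-Reasoning

open Linear

∂-linear : (c : Subset m) (τ : Subset m) → Linear (λ f → ∂ c f τ)
∂-linear []      []            .ℓ-cong f≗g       = refl
∂-linear []      []            .ℓ-lin a b f g    =
  solve 2 (λ a b → con 0ℚ := a :* con 0ℚ :+ b :* con 0ℚ) refl a b
∂-linear (s ∷ c) (outside ∷ τ) .ℓ-cong f≗g       =
  cong₂ _+_ (cong (χ s *_) (f≗g (inside ∷ τ))) (∂-linear c τ .ℓ-cong (f≗g ∘ (outside ∷_)))
∂-linear (s ∷ c) (outside ∷ τ) .ℓ-lin a b f g    = trans
  (cong (χ s * (a * f (inside ∷ τ) + b * g (inside ∷ τ)) +_) (∂-linear c τ .ℓ-lin a b _ _))
  (solve 7 (λ s a b x y x′ y′ → s :* (a :* x :+ b :* y) :+ (a :* x′ :+ b :* y′)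
                             := a :* (s :* x :+ x′) :+ b :* (s :* y :+ y′)) refl
    (χ s) a b (f (inside ∷ τ)) (g (inside ∷ τ)) (∂ c (f ∘ (outside ∷_)) τ) (∂ c (g ∘ (outside ∷_)) τ))
∂-linear (s ∷ c) (inside ∷ τ)  .ℓ-cong f≗g       = cong -_ (∂-linear c τ .ℓ-cong (f≗g ∘ (inside ∷_)))
∂-linear (s ∷ c) (inside ∷ τ)  .ℓ-lin a b f g    = trans
  (cong -_ (∂-linear c τ .ℓ-lin a b _ _))
  (solve 4 (λ a b x y → :- (a :* x :+ b :* y) := a :* (:- x) :+ b :* (:- y)) refl
    a b (∂ c (f ∘ (inside ∷_)) τ) (∂ c (g ∘ (inside ∷_)) τ))

δ-linear : (c : Subset m) (τ : Subset m) → Linear (λ f → δ c f τ)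
δ-linear []      []            .ℓ-cong f≗g       = refl
δ-linear []      []            .ℓ-lin a b f g    =
  solve 2 (λ a b → con 0ℚ := a :* con 0ℚ :+ b :* con 0ℚ) refl a b
δ-linear (s ∷ c) (outside ∷ τ) .ℓ-cong f≗g       = δ-linear c τ .ℓ-cong (f≗g ∘ (outside ∷_))
δ-linear (s ∷ c) (outside ∷ τ) .ℓ-lin a b f g    = δ-linear c τ .ℓ-lin a b _ _
δ-linear (s ∷ c) (inside ∷ τ)  .ℓ-cong f≗g       =
  cong₂ _-_ (cong (χ s *_) (f≗g (outside ∷ τ))) (δ-linear c τ .ℓ-cong (f≗g ∘ (inside ∷_)))
δ-linear (s ∷ c) (inside ∷ τ)  .ℓ-lin a b f g    = trans
  (cong (λ x → χ s * (a * f (outside ∷ τ) + b * g (outside ∷ τ)) - x) (δ-linear c τ .ℓ-lin a b _ _))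
  (solve 7 (λ s a b x y x′ y′ → s :* (a :* x :+ b :* y) :- (a :* x′ :+ b :* y′)
                             := a :* (s :* x :- x′) :+ b :* (s :* y :- y′)) refl
    (χ s) a b (f (outside ∷ τ)) (g (outside ∷ τ)) (δ c (f ∘ (inside ∷_)) τ) (δ c (g ∘ (inside ∷_)) τ))

-- Here `∂ c` acts on the index of the family `F`. Its value at `J` is a finite signed combination
-- of members of `F`, so a linear functional passes through it.
∂-commute : ∀ {ℓ : Chain m → ℚ} → Linear ℓ → ∀ c (F : Subset n → Chain m) J →
            ℓ (λ σ → ∂ c (λ I → F I σ) J) ≡ ∂ c (λ I → ℓ (F I)) J
∂-commute {ℓ = ℓ} lin []      F []            = ℓ-zero lin
∂-commute {ℓ = ℓ} lin (s ∷ c) F (outside ∷ J) = trans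
  (ℓ-scale-add lin (χ s) (F (inside ∷ J)) (λ σ → ∂ c (λ I → F (outside ∷ I) σ) J))
  (cong (χ s * ℓ (F (inside ∷ J)) +_) (∂-commute lin c (F ∘ (outside ∷_)) J))
∂-commute {ℓ = ℓ} lin (s ∷ c) F (inside ∷ J)  = trans
  (ℓ-neg lin (λ σ → ∂ c (λ I → F (inside ∷ I) σ) J))
  (cong -_ (∂-commute lin c (F ∘ (inside ∷_)) J))

δ-commute : ∀ {ℓ : Chain m → ℚ} → Linear ℓ → ∀ c (F : Subset n → Chain m) J →
            ℓ (λ σ → δ c (λ I → F I σ) J) ≡ δ c (λ I → ℓ (F I)) J
δ-commute {ℓ = ℓ} lin []      F []            = ℓ-zero lin
δ-commute {ℓ = ℓ} lin (s ∷ c) F (outside ∷ J) = δ-commute lin c (F ∘ (outside ∷_)) J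
δ-commute {ℓ = ℓ} lin (s ∷ c) F (inside ∷ J)  = trans
  (ℓ-scale-sub lin (χ s) (F (outside ∷ J)) (λ σ → δ c (λ I → F (inside ∷ I) σ) J))
  (cong (λ x → χ s * ℓ (F (outside ∷ J)) - x) (δ-commute lin c (F ∘ (inside ∷_)) J))

-- The signs depend only on `σ` and the added element `w`, which enters with weight
-- `χ (lookup c w)`. Comparing weighted terms thus compares boundaries over different element sets.
∂-local : ∀ (c c′ : Subset m) f f′ σ →
          (∀ w → w ∉ σ → χ (lookup c w) * f (σ [ w ]≔ inside) ≡ χ (lookup c′ w) * f′ (σ [ w ]≔ inside)) →
          ∂ c f σ ≡ ∂ c′ f′ σ
∂-local []      []        f f′ []            eq = refl
∂-local (s ∷ c) (s′ ∷ c′) f f′ (outside ∷ σ) eq = cong₂ _+_ (eq zero λ ())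
  (∂-local c c′ _ _ σ λ w w∉σ → eq (suc w) λ { (there w∈σ) → w∉σ w∈σ })
∂-local (s ∷ c) (s′ ∷ c′) f f′ (inside ∷ σ)  eq = cong -_
  (∂-local c c′ _ _ σ λ w w∉σ → eq (suc w) λ { (there w∈σ) → w∉σ w∈σ })

δ-local : ∀ (c c′ : Subset m) f f′ σ →
          (∀ w → w ∈ σ → χ (lookup c w) * f (σ [ w ]≔ outside) ≡ χ (lookup c′ w) * f′ (σ [ w ]≔ outside)) →
          δ c f σ ≡ δ c′ f′ σ
δ-local []      []        f f′ []            eq = refl
δ-local (s ∷ c) (s′ ∷ c′) f f′ (outside ∷ σ) eq = δ-local c c′ _ _ σ λ w w∈σ → eq (suc w) (there w∈σ)
δ-local (s ∷ c) (s′ ∷ c′) f f′ (inside ∷ σ)  eq = cong₂ _-_ (eq zero here)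
  (δ-local c c′ _ _ σ λ w w∈σ → eq (suc w) (there w∈σ))

∂-vanish : ∀ (c : Subset m) f σ → (∀ w → w ∉ σ → f (σ [ w ]≔ inside) ≡ 0ℚ) → ∂ c f σ ≡ 0ℚ
∂-vanish c f σ f≡0 = trans
  (∂-local c c f (λ _ → 0ℚ) σ λ w w∉σ → cong (χ (lookup c w) *_) (f≡0 w w∉σ))
  (ℓ-zero (∂-linear c σ))

δ-vanish : ∀ (c : Subset m) f σ → (∀ w → w ∈ σ → χ (lookup c w) * f (σ [ w ]≔ outside) ≡ 0ℚ) → δ c f σ ≡ 0ℚ
δ-vanish c f σ f≡0 = trans
  (δ-local c c f (λ _ → 0ℚ) σ λ w w∈σ → trans (f≡0 w w∈σ) (sym (ℚ.*-zeroʳ (χ (lookup c w)))))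
  (ℓ-zero (δ-linear c σ))

-- Anticommutation of boundary and coboundary

ι : ℕ → ℚ
ι zero    = 0ℚ
ι (suc n) = 1ℚ + ι n

*-nonzero : ∀ {x y} → x ≢ 0ℚ → y ≢ 0ℚ → x * y ≢ 0ℚ
*-nonzero {x} {y} x≢0 y≢0 xy≡0 = y≢0 (begin
  y               ≡⟨ sym (ℚ.*-identityˡ y) ⟩
  1ℚ * y          ≡⟨ cong (_* y) (sym (ℚ.*-inverseˡ x)) ⟩
  1/ x * x * y    ≡⟨ ℚ.*-assoc (1/ x) x y ⟩
  1/ x * (x * y)  ≡⟨ cong (1/ x *_) xy≡0 ⟩
  1/ x * 0ℚ       ≡⟨ ℚ.*-zeroʳ (1/ x) ⟩
  0ℚ              ∎)
  where
  open ≡-Reasoning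
  instance _ = ≢-nonZero x≢0

χ-∩ : ∀ s t (c d : Subset m) x → χ s * χ t * x + ι ∣ c ∩ d ∣ * x ≡ ι ∣ (s ∷ c) ∩ (t ∷ d) ∣ * x
χ-∩ outside t       c d x = solve 3 (λ t i x → con 0ℚ :* t :* x :+ i :* x := i :* x) refl (χ t) (ι ∣ c ∩ d ∣) x
χ-∩ inside  outside c d x = solve 2 (λ i x → con 1ℚ :* con 0ℚ :* x :+ i :* x := i :* x) refl (ι ∣ c ∩ d ∣) x
χ-∩ inside  inside  c d x = solve 2 (λ i x → con 1ℚ :* con 1ℚ :* x :+ i :* x := (con 1ℚ :+ i) :* x) refl (ι ∣ c ∩ d ∣) x

-- Induction on the ground set: the head contributes `χ s * χ t`, and the mixed terms cancel because
-- passing an included head flips the sign. The case `c = d` gives the Laplacian; a singleton `d`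
-- gives the boundary of a cone.
anticommutator : ∀ (c d : Subset m) f σ → ∂ c (δ d f) σ + δ d (∂ c f) σ ≡ ι ∣ c ∩ d ∣ * f σ
anticommutator []      []      f []            = sym (ℚ.*-zeroˡ (f []))
anticommutator (s ∷ c) (t ∷ d) f (outside ∷ τ) = begin
  χ s * (χ t * x - δ d f₁ τ) + ∂ c (δ d f₀) τ + δ d (λ σ → χ s * f₁ σ + ∂ c f₀ σ) τ
    ≡⟨ cong (χ s * (χ t * x - δ d f₁ τ) + ∂ c (δ d f₀) τ +_) (ℓ-scale-add (δ-linear d τ) (χ s) f₁ (∂ c f₀)) ⟩
  χ s * (χ t * x - δ d f₁ τ) + ∂ c (δ d f₀) τ + (χ s * δ d f₁ τ + δ d (∂ c f₀) τ)
    ≡⟨ solve 6 (λ s t x y u v → s :* (t :* x :- y) :+ u :+ (s :* y :+ v) := s :* t :* x :+ (u :+ v)) refl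
         (χ s) (χ t) x (δ d f₁ τ) (∂ c (δ d f₀) τ) (δ d (∂ c f₀) τ) ⟩
  χ s * χ t * x + (∂ c (δ d f₀) τ + δ d (∂ c f₀) τ)
    ≡⟨ cong (χ s * χ t * x +_) (anticommutator c d f₀ τ) ⟩
  χ s * χ t * x + ι ∣ c ∩ d ∣ * x
    ≡⟨ χ-∩ s t c d x ⟩
  ι ∣ (s ∷ c) ∩ (t ∷ d) ∣ * x ∎
  where
  open ≡-Reasoning
  f₀ = f ∘ (outside ∷_)
  f₁ = f ∘ (inside ∷_)
  x  = f (outside ∷ τ)
anticommutator (s ∷ c) (t ∷ d) f (inside ∷ τ)  = begin
  - ∂ c (λ σ → χ t * f₀ σ - δ d f₁ σ) τ + (χ t * (χ s * x + ∂ c f₀ τ) - δ d (λ σ → - ∂ c f₁ σ) τ)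
    ≡⟨ cong₂ (λ p q → - p + (χ t * (χ s * x + ∂ c f₀ τ) - q))
         (ℓ-scale-sub (∂-linear c τ) (χ t) f₀ (δ d f₁)) (ℓ-neg (δ-linear d τ) (∂ c f₁)) ⟩
  - (χ t * ∂ c f₀ τ - ∂ c (δ d f₁) τ) + (χ t * (χ s * x + ∂ c f₀ τ) - - δ d (∂ c f₁) τ)
    ≡⟨ solve 6 (λ s t x y u v → :- (t :* y :- u) :+ (t :* (s :* x :+ y) :- :- v) := s :* t :* x :+ (u :+ v)) refl
         (χ s) (χ t) x (∂ c f₀ τ) (∂ c (δ d f₁) τ) (δ d (∂ c f₁) τ) ⟩
  χ s * χ t * x + (∂ c (δ d f₁) τ + δ d (∂ c f₁) τ)
    ≡⟨ cong (χ s * χ t * x +_) (anticommutator c d f₁ τ) ⟩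
  χ s * χ t * x + ι ∣ c ∩ d ∣ * x
    ≡⟨ χ-∩ s t c d x ⟩
  ι ∣ (s ∷ c) ∩ (t ∷ d) ∣ * x ∎
  where
  open ≡-Reasoning
  f₀ = f ∘ (outside ∷_)
  f₁ = f ∘ (inside ∷_)
  x  = f (inside ∷ τ)

∂∂≡0 : ∀ (c : Subset m) f σ → ∂ c (∂ c f) σ ≡ 0ℚ
∂∂≡0 []      f []            = refl
∂∂≡0 (s ∷ c) f (outside ∷ τ) = begin
  χ s * - ∂ c f₁ τ + ∂ c (λ σ → χ s * f₁ σ + ∂ c f₀ σ) τ
    ≡⟨ cong (χ s * - ∂ c f₁ τ +_) (ℓ-scale-add (∂-linear c τ) (χ s) f₁ (∂ c f₀)) ⟩
  χ s * - ∂ c f₁ τ + (χ s * ∂ c f₁ τ + ∂ c (∂ c f₀) τ)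
    ≡⟨ solve 3 (λ s x y → s :* :- x :+ (s :* x :+ y) := y) refl (χ s) (∂ c f₁ τ) (∂ c (∂ c f₀) τ) ⟩
  ∂ c (∂ c f₀) τ
    ≡⟨ ∂∂≡0 c f₀ τ ⟩
  0ℚ ∎
  where
  open ≡-Reasoning
  f₀ = f ∘ (outside ∷_)
  f₁ = f ∘ (inside ∷_)
∂∂≡0 (s ∷ c) f (inside ∷ τ)  = begin
  - ∂ c (λ σ → - ∂ c f₁ σ) τ  ≡⟨ cong -_ (ℓ-neg (∂-linear c τ) (∂ c f₁)) ⟩
  - - ∂ c (∂ c f₁) τ          ≡⟨ cong (λ x → - - x) (∂∂≡0 c f₁ τ) ⟩
  0ℚ                          ∎
  where
  open ≡-Reasoning
  f₁ = f ∘ (inside ∷_)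

δδ≡0 : ∀ (c : Subset m) f σ → δ c (δ c f) σ ≡ 0ℚ
δδ≡0 []      f []            = refl
δδ≡0 (s ∷ c) f (outside ∷ τ) = δδ≡0 c (f ∘ (outside ∷_)) τ
δδ≡0 (s ∷ c) f (inside ∷ τ)  = begin
  χ s * δ c f₀ τ - δ c (λ σ → χ s * f₀ σ - δ c f₁ σ) τ
    ≡⟨ cong (λ x → χ s * δ c f₀ τ - x) (ℓ-scale-sub (δ-linear c τ) (χ s) f₀ (δ c f₁)) ⟩
  χ s * δ c f₀ τ - (χ s * δ c f₀ τ - δ c (δ c f₁) τ)
    ≡⟨ solve 2 (λ x y → x :- (x :- y) := y) refl (χ s * δ c f₀ τ) (δ c (δ c f₁) τ) ⟩
  δ c (δ c f₁) τ
    ≡⟨ δδ≡0 c f₁ τ ⟩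
  0ℚ ∎
  where
  open ≡-Reasoning
  f₀ = f ∘ (outside ∷_)
  f₁ = f ∘ (inside ∷_)

-- Inner product and norm of chains

∑ : Chain m → ℚ
∑ {zero}  f = f []
∑ {suc m} f = ∑ (f ∘ (outside ∷_)) + ∑ (f ∘ (inside ∷_))

∑-linear : Linear (∑ {m})
∑-linear {zero}  .ℓ-cong f≗g    = f≗g []
∑-linear {zero}  .ℓ-lin a b f g = refl
∑-linear {suc m} .ℓ-cong f≗g    =
  cong₂ _+_ (∑-linear .ℓ-cong (f≗g ∘ (outside ∷_))) (∑-linear .ℓ-cong (f≗g ∘ (inside ∷_)))
∑-linear {suc m} .ℓ-lin a b f g = trans
  (cong₂ _+_ (∑-linear {m} .ℓ-lin a b (f ∘ (outside ∷_)) (g ∘ (outside ∷_)))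
             (∑-linear {m} .ℓ-lin a b (f ∘ (inside ∷_)) (g ∘ (inside ∷_))))
  (solve 6 (λ a b x y x′ y′ → (a :* x :+ b :* y) :+ (a :* x′ :+ b :* y′)
                           := a :* (x :+ x′) :+ b :* (y :+ y′)) refl
    a b (∑ (f ∘ (outside ∷_))) (∑ (g ∘ (outside ∷_))) (∑ (f ∘ (inside ∷_))) (∑ (g ∘ (inside ∷_))))

∑-mono-≤ : {f g : Chain m} → (∀ σ → f σ ≤ g σ) → ∑ f ≤ ∑ g
∑-mono-≤ {zero}  f≤g = f≤g []
∑-mono-≤ {suc m} f≤g = ℚ.+-mono-≤ (∑-mono-≤ (f≤g ∘ (outside ∷_))) (∑-mono-≤ (f≤g ∘ (inside ∷_)))

∑≢0⇒∃≢0 : (f : Chain m) → ∑ f ≢ 0ℚ → ∃ λ σ → f σ ≢ 0ℚ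
∑≢0⇒∃≢0 {zero}  f f≢0 = [] , f≢0
∑≢0⇒∃≢0 {suc m} f f≢0 with ∑ (f ∘ (outside ∷_)) ≟ 0ℚ
... | no  f₀≢0 = let σ , fσ≢0 = ∑≢0⇒∃≢0 (f ∘ (outside ∷_)) f₀≢0 in outside ∷ σ , fσ≢0
... | yes f₀≡0 =
  let σ , fσ≢0 = ∑≢0⇒∃≢0 (f ∘ (inside ∷_)) (λ f₁≡0 → f≢0 (cong₂ _+_ f₀≡0 f₁≡0)) in inside ∷ σ , fσ≢0

⟨_,_⟩ : Chain m → Chain m → ℚ
⟨ f , g ⟩ = ∑ (λ σ → f σ * g σ)

⟨,⟩-comm : (f g : Chain m) → ⟨ f , g ⟩ ≡ ⟨ g , f ⟩
⟨,⟩-comm f g = ∑-linear .ℓ-cong (λ σ → ℚ.*-comm (f σ) (g σ))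

⟨,⟩-linear : (f : Chain m) → Linear ⟨ f ,_⟩
⟨,⟩-linear f .ℓ-cong g≗h    = ∑-linear .ℓ-cong (λ σ → cong (f σ *_) (g≗h σ))
⟨,⟩-linear f .ℓ-lin a b g h = trans
  (∑-linear .ℓ-cong λ σ → solve 5 (λ a b f g h → f :* (a :* g :+ b :* h) := a :* (f :* g) :+ b :* (f :* h)) refl
    a b (f σ) (g σ) (h σ))
  (∑-linear .ℓ-lin a b (λ σ → f σ * g σ) (λ σ → f σ * h σ))

adjoint : ∀ (c : Subset m) f g → ⟨ ∂ c f , g ⟩ ≡ ⟨ f , δ c g ⟩
adjoint []      f g = trans (ℚ.*-zeroˡ (g [])) (sym (ℚ.*-zeroʳ (f [])))
adjoint (s ∷ c) f g = begin
  ∑ (λ σ → (χ s * f₁ σ + ∂ c f₀ σ) * g₀ σ) + ∑ (λ σ → - ∂ c f₁ σ * g₁ σ)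
    ≡⟨ cong₂ _+_
         (trans (∑-linear .ℓ-cong λ σ → solve 4 (λ s x y z → (s :* x :+ y) :* z := s :* (x :* z) :+ y :* z) refl
                   (χ s) (f₁ σ) (∂ c f₀ σ) (g₀ σ))
                (ℓ-scale-add ∑-linear (χ s) (λ σ → f₁ σ * g₀ σ) (λ σ → ∂ c f₀ σ * g₀ σ)))
         (trans (∑-linear .ℓ-cong λ σ → sym (ℚ.neg-distribˡ-* (∂ c f₁ σ) (g₁ σ)))
                (ℓ-neg ∑-linear (λ σ → ∂ c f₁ σ * g₁ σ))) ⟩
  χ s * ⟨ f₁ , g₀ ⟩ + ⟨ ∂ c f₀ , g₀ ⟩ + - ⟨ ∂ c f₁ , g₁ ⟩
    ≡⟨ cong₂ (λ x y → χ s * ⟨ f₁ , g₀ ⟩ + x + - y) (adjoint c f₀ g₀) (adjoint c f₁ g₁) ⟩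
  χ s * ⟨ f₁ , g₀ ⟩ + ⟨ f₀ , δ c g₀ ⟩ + - ⟨ f₁ , δ c g₁ ⟩
    ≡⟨ solve 3 (λ x y z → x :+ y :+ :- z := y :+ (x :- z)) refl
         (χ s * ⟨ f₁ , g₀ ⟩) ⟨ f₀ , δ c g₀ ⟩ ⟨ f₁ , δ c g₁ ⟩ ⟩
  ⟨ f₀ , δ c g₀ ⟩ + (χ s * ⟨ f₁ , g₀ ⟩ - ⟨ f₁ , δ c g₁ ⟩)
    ≡⟨ cong (⟨ f₀ , δ c g₀ ⟩ +_) (sym (ℓ-scale-sub (⟨,⟩-linear f₁) (χ s) g₀ (δ c g₁))) ⟩
  ⟨ f₀ , δ c g₀ ⟩ + ⟨ f₁ , (λ σ → χ s * g₀ σ - δ c g₁ σ) ⟩ ∎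
  where
  open ≡-Reasoning
  f₀ = f ∘ (outside ∷_)
  f₁ = f ∘ (inside ∷_)
  g₀ = g ∘ (outside ∷_)
  g₁ = g ∘ (inside ∷_)

∥_∥² : Chain m → ℚ
∥ f ∥² = ⟨ f , f ⟩

-- By adjointness the left side pairs `f` with its Laplacian, which `anticommutator` identifies as
-- multiplication by `∣ c ∣`.
∥∂∥²+∥δ∥² : ∀ (c : Subset m) f → ∥ ∂ c f ∥² + ∥ δ c f ∥² ≡ ι ∣ c ∣ * ∥ f ∥²
∥∂∥²+∥δ∥² c f = begin
  ∥ ∂ c f ∥² + ∥ δ c f ∥²
    ≡⟨ cong₂ _+_ (adjoint c f (∂ c f)) (trans (sym (adjoint c (δ c f) f)) (⟨,⟩-comm (∂ c (δ c f)) f)) ⟩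
  ⟨ f , δ c (∂ c f) ⟩ + ⟨ f , ∂ c (δ c f) ⟩
    ≡⟨ ℚ.+-comm _ ⟨ f , ∂ c (δ c f) ⟩ ⟩
  ⟨ f , ∂ c (δ c f) ⟩ + ⟨ f , δ c (∂ c f) ⟩
    ≡⟨ cong (_+ ⟨ f , δ c (∂ c f) ⟩) (sym (ℚ.*-identityˡ ⟨ f , ∂ c (δ c f) ⟩)) ⟩
  1ℚ * ⟨ f , ∂ c (δ c f) ⟩ + ⟨ f , δ c (∂ c f) ⟩
    ≡⟨ sym (ℓ-scale-add (⟨,⟩-linear f) 1ℚ (∂ c (δ c f)) (δ c (∂ c f))) ⟩
  ⟨ f , (λ σ → 1ℚ * ∂ c (δ c f) σ + δ c (∂ c f) σ) ⟩
    ≡⟨ ⟨,⟩-linear f .ℓ-cong (λ σ → trans (cong (_+ δ c (∂ c f) σ) (ℚ.*-identityˡ (∂ c (δ c f) σ))) (anticommutator c c f σ)) ⟩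
  ⟨ f , (λ σ → ι ∣ c ∩ c ∣ * f σ) ⟩
    ≡⟨ ℓ-scale (⟨,⟩-linear f) (ι ∣ c ∩ c ∣) f ⟩
  ι ∣ c ∩ c ∣ * ∥ f ∥²
    ≡⟨ cong (λ d → ι ∣ d ∣ * ∥ f ∥²) (∩-idem c) ⟩
  ι ∣ c ∣ * ∥ f ∥² ∎
  where open ≡-Reasoning

square-nonNeg : ∀ x → 0ℚ ≤ x * x
square-nonNeg x with ℚ.≤-total 0ℚ x
... | inj₁ 0≤x = let instance _ = nonNegative 0≤x in ℚ.nonNegative⁻¹ (x * x) {{ℚ.nonNeg*nonNeg⇒nonNeg x x}}
... | inj₂ x≤0 = let instance _ = nonPositive x≤0 in ℚ.nonNegative⁻¹ (x * x) {{ℚ.nonPos*nonPos⇒nonPos x x}}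

∥∥²-nonNeg : (f : Chain m) → 0ℚ ≤ ∥ f ∥²
∥∥²-nonNeg {m} f = ℚ.≤-trans (ℚ.≤-reflexive (sym (ℓ-zero (∑-linear {m})))) (∑-mono-≤ (λ σ → square-nonNeg (f σ)))

+≤0⇒≤0ˡ : ∀ {x y} → 0ℚ ≤ y → x + y ≤ 0ℚ → x ≤ 0ℚ
+≤0⇒≤0ˡ {x} {y} 0≤y x+y≤0 = ℚ.≤-trans (ℚ.≤-reflexive (sym (ℚ.+-identityʳ x))) (ℚ.≤-trans (ℚ.+-monoʳ-≤ x 0≤y) x+y≤0)

∥∥²-definite : (f : Chain m) → ∥ f ∥² ≤ 0ℚ → ∀ σ → f σ ≡ 0ℚ
∥∥²-definite f ∥f∥²≤0 [] with f [] ≟ 0ℚ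
... | yes f≡0 = f≡0
... | no  f≢0 = contradiction (ℚ.≤-antisym ∥f∥²≤0 (square-nonNeg (f []))) (*-nonzero f≢0 f≢0)
∥∥²-definite f ∥f∥²≤0 (outside ∷ σ) = ∥∥²-definite (f ∘ (outside ∷_)) (+≤0⇒≤0ˡ (∥∥²-nonNeg (f ∘ (inside ∷_))) ∥f∥²≤0) σ
∥∥²-definite f ∥f∥²≤0 (inside ∷ σ)  = ∥∥²-definite (f ∘ (inside ∷_))
  (+≤0⇒≤0ˡ (∥∥²-nonNeg (f ∘ (outside ∷_))) (ℚ.≤-trans (ℚ.≤-reflexive (ℚ.+-comm ∥ f ∘ (inside ∷_) ∥² ∥ f ∘ (outside ∷_) ∥²)) ∥f∥²≤0)) σ

basis : Subset m → Chain m
basis []            []            = 1ℚ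
basis (outside ∷ σ) (outside ∷ τ) = basis σ τ
basis (outside ∷ σ) (inside  ∷ τ) = 0ℚ
basis (inside  ∷ σ) (outside ∷ τ) = 0ℚ
basis (inside  ∷ σ) (inside  ∷ τ) = basis σ τ

⟨,basis⟩ : (f : Chain m) → ∀ σ → ⟨ f , basis σ ⟩ ≡ f σ
⟨,basis⟩ f []            = ℚ.*-identityʳ (f [])
⟨,basis⟩ f (outside ∷ σ) = trans
  (cong₂ _+_ (⟨,basis⟩ (f ∘ (outside ∷_)) σ) (ℓ-vanish ∑-linear λ τ → ℚ.*-zeroʳ (f (inside ∷ τ))))
  (ℚ.+-identityʳ (f (outside ∷ σ)))
⟨,basis⟩ f (inside ∷ σ)  = trans
  (cong₂ _+_ (ℓ-vanish ∑-linear λ τ → ℚ.*-zeroʳ (f (outside ∷ τ))) (⟨,basis⟩ (f ∘ (inside ∷_)) σ))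
  (ℚ.+-identityˡ (f (inside ∷ σ)))

basis-support : ∀ (σ τ : Subset m) → basis σ τ ≢ 0ℚ → τ ≡ σ
basis-support []            []            _   = refl
basis-support (outside ∷ σ) (outside ∷ τ) b≢0 = cong (outside ∷_) (basis-support σ τ b≢0)
basis-support (outside ∷ σ) (inside  ∷ τ) b≢0 = contradiction refl b≢0
basis-support (inside  ∷ σ) (outside ∷ τ) b≢0 = contradiction refl b≢0
basis-support (inside  ∷ σ) (inside  ∷ τ) b≢0 = cong (inside ∷_) (basis-support σ τ b≢0)

-- Orthogonal projection

subsets : ∀ m → List (Subset m)
subsets zero    = [] ∷ []
subsets (suc m) = List.map (outside ∷_) (subsets m) ++ List.map (inside ∷_) (subsets m)

∈-subsets : (σ : Subset m) → σ ∈ˡ subsets m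
∈-subsets []                = Any.here refl
∈-subsets (outside ∷ σ)     = ∈-++⁺ˡ (∈-map⁺ (outside ∷_) (∈-subsets σ))
∈-subsets {suc m} (inside ∷ σ) =
  ∈-++⁺ʳ (List.map (outside ∷_) (subsets m)) (∈-map⁺ (inside ∷_) (∈-subsets σ))

_SupportedOn_ : Chain m → (Subset m → Set) → Set
f SupportedOn P = ∀ σ → ¬ P σ → f σ ≡ 0ℚ

-- The Gram-Schmidt coefficient of `r` along `v`. If `v` has norm zero it vanishes and `0ℚ` serves,
-- so the generators may be linearly dependent.
ratio : (v r : Chain m) → ∃ λ a → ⟨ r , v ⟩ ≡ a * ∥ v ∥²
ratio v r with ∥ v ∥² ≟ 0ℚ
... | yes ∥v∥²≡0 = 0ℚ , trans
  (ℓ-vanish (⟨,⟩-linear r) (∥∥²-definite v (ℚ.≤-reflexive ∥v∥²≡0)))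
  (sym (ℚ.*-zeroˡ ∥ v ∥²))
... | no  ∥v∥²≢0 = ⟨ r , v ⟩ * 1/ ∥ v ∥² , (begin
  ⟨ r , v ⟩                          ≡⟨ sym (ℚ.*-identityʳ ⟨ r , v ⟩) ⟩
  ⟨ r , v ⟩ * 1ℚ                     ≡⟨ cong (⟨ r , v ⟩ *_) (sym (ℚ.*-inverseˡ ∥ v ∥²)) ⟩
  ⟨ r , v ⟩ * (1/ ∥ v ∥² * ∥ v ∥²)   ≡⟨ sym (ℚ.*-assoc ⟨ r , v ⟩ (1/ ∥ v ∥²) ∥ v ∥²) ⟩
  ⟨ r , v ⟩ * 1/ ∥ v ∥² * ∥ v ∥²     ∎)
  where
  open ≡-Reasoning
  instance _ = ≢-nonZero ∥v∥²≢0

-- Gram–Schmidt; the middle condition says that T w lies in the span of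
-- the T g.
module _ {T : Chain m → Chain m} (T-linear : ∀ τ → Linear (λ f → T f τ)) {P : Subset m → Set} where

  Orthogonal : List (Chain m) → Chain m → Set
  Orthogonal gs y = All (λ g → ⟨ y , T g ⟩ ≡ 0ℚ) gs

  Projection : List (Chain m) → Chain m → Set
  Projection gs z = ∃ λ w → w SupportedOn P
    × (∀ y → Orthogonal gs y → ⟨ y , T w ⟩ ≡ 0ℚ)
    × Orthogonal gs (λ σ → z σ - T w σ)

  project : ∀ gs → All (_SupportedOn P) gs → ∀ z → Projection gs z
  project []       []         z = (λ _ → 0ℚ) , (λ _ _ → refl)
    , (λ y _ → ℓ-vanish (⟨,⟩-linear y) (λ σ → ℓ-zero (T-linear σ))) , []
  project (g ∷ gs) (g-P ∷ gs-P) z = w′ , w′-P , span , orth-g ∷ orth-gs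
    where
    open ≡-Reasoning

    ih-z = project gs gs-P z
    ih-g = project gs gs-P (T g)

    w = proj₁ ih-z
    u = proj₁ ih-g

    r v : Chain m
    r σ = z σ - T w σ
    v σ = T g σ - T u σ

    u-span = proj₁ (proj₂ (proj₂ ih-g))

    -- `v` is the component of `T g` orthogonal to the earlier images. Moving by `a` times `v`
    -- corrects the residual along `g` and keeps it orthogonal to the others.
    a = proj₁ (ratio v r)

    w′ : Chain m
    w′ σ = a * (g σ - u σ) + w σ

    w′-P : w′ SupportedOn P
    w′-P σ ¬Pσ = begin
      a * (g σ - u σ) + w σ
        ≡⟨ cong₂ (λ x y → a * x + y) (cong₂ _-_ (g-P σ ¬Pσ) (proj₁ (proj₂ ih-g) σ ¬Pσ)) (proj₁ (proj₂ ih-z) σ ¬Pσ) ⟩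
      a * 0ℚ + 0ℚ            ≡⟨ solve 1 (λ a → a :* con 0ℚ :+ con 0ℚ := con 0ℚ) refl a ⟩
      0ℚ                     ∎

    Tw′ : ∀ σ → T w′ σ ≡ a * v σ + T w σ
    Tw′ σ = trans (ℓ-scale-add (T-linear σ) a (λ τ → g τ - u τ) w)
                  (cong (λ x → a * x + T w σ) (ℓ-sub (T-linear σ) g u))

    span : ∀ y → Orthogonal (g ∷ gs) y → ⟨ y , T w′ ⟩ ≡ 0ℚ
    span y (y⊥g ∷ y⊥gs) = begin
      ⟨ y , T w′ ⟩                                  ≡⟨ ⟨,⟩-linear y .ℓ-cong Tw′ ⟩
      ⟨ y , (λ σ → a * v σ + T w σ) ⟩               ≡⟨ ℓ-scale-add (⟨,⟩-linear y) a v (T w) ⟩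
      a * ⟨ y , v ⟩ + ⟨ y , T w ⟩
        ≡⟨ cong (λ x → a * x + ⟨ y , T w ⟩) (ℓ-sub (⟨,⟩-linear y) (T g) (T u)) ⟩
      a * (⟨ y , T g ⟩ - ⟨ y , T u ⟩) + ⟨ y , T w ⟩
        ≡⟨ cong₂ (λ p q → a * p + q) (cong₂ _-_ y⊥g (u-span y y⊥gs)) (proj₁ (proj₂ (proj₂ ih-z)) y y⊥gs) ⟩
      a * 0ℚ + 0ℚ                                   ≡⟨ solve 1 (λ a → a :* con 0ℚ :+ con 0ℚ := con 0ℚ) refl a ⟩
      0ℚ                                            ∎

    r′ : Chain m
    r′ σ = z σ - T w′ σ

    ⟨r′,⟩ : ∀ h → ⟨ r′ , h ⟩ ≡ ⟨ r , h ⟩ - a * ⟨ v , h ⟩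
    ⟨r′,⟩ h = begin
      ⟨ r′ , h ⟩                            ≡⟨ ⟨,⟩-comm r′ h ⟩
      ⟨ h , r′ ⟩                            ≡⟨ ⟨,⟩-linear h .ℓ-cong (λ σ → trans (cong (λ x → z σ - x) (Tw′ σ))
                                               (solve 4 (λ z a v t → z :- (a :* v :+ t) := con (- 1ℚ) :* (a :* v) :+ (z :- t)) refl (z σ) a (v σ) (T w σ))) ⟩
      ⟨ h , (λ σ → - 1ℚ * (a * v σ) + r σ) ⟩ ≡⟨ ℓ-scale-add (⟨,⟩-linear h) (- 1ℚ) (λ σ → a * v σ) r ⟩
      - 1ℚ * ⟨ h , (λ σ → a * v σ) ⟩ + ⟨ h , r ⟩
        ≡⟨ cong₂ (λ p q → - 1ℚ * p + q) (ℓ-scale (⟨,⟩-linear h) a v) (⟨,⟩-comm h r) ⟩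
      - 1ℚ * (a * ⟨ h , v ⟩) + ⟨ r , h ⟩    ≡⟨ cong (λ p → - 1ℚ * (a * p) + ⟨ r , h ⟩) (⟨,⟩-comm h v) ⟩
      - 1ℚ * (a * ⟨ v , h ⟩) + ⟨ r , h ⟩
        ≡⟨ solve 2 (λ x y → con (- 1ℚ) :* x :+ y := y :- x) refl (a * ⟨ v , h ⟩) ⟨ r , h ⟩ ⟩
      ⟨ r , h ⟩ - a * ⟨ v , h ⟩             ∎

    orth-gs : Orthogonal gs r′
    orth-gs = All.zipWith (λ {h} (r⊥h , v⊥h) → trans (⟨r′,⟩ (T h)) (trans (cong₂ (λ p q → p - a * q) r⊥h v⊥h)
        (solve 1 (λ a → con 0ℚ :- a :* con 0ℚ := con 0ℚ) refl a)))
      (proj₂ (proj₂ (proj₂ ih-z)) , proj₂ (proj₂ (proj₂ ih-g)))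

    orth-v : ⟨ r′ , v ⟩ ≡ 0ℚ
    orth-v = trans (⟨r′,⟩ v) (trans (cong (_- a * ∥ v ∥²) (proj₂ (ratio v r))) (ℚ.+-inverseʳ (a * ∥ v ∥²)))

    -- `T g` is `v` plus `T u`: the choice of `a` handles `v`, and `T u` lies in the span of the
    -- earlier images.
    orth-g : ⟨ r′ , T g ⟩ ≡ 0ℚ
    orth-g = begin
      ⟨ r′ , T g ⟩
        ≡⟨ solve 2 (λ x y → x := (x :- y) :+ y) refl ⟨ r′ , T g ⟩ ⟨ r′ , T u ⟩ ⟩
      (⟨ r′ , T g ⟩ - ⟨ r′ , T u ⟩) + ⟨ r′ , T u ⟩
        ≡⟨ cong (_+ ⟨ r′ , T u ⟩) (sym (ℓ-sub (⟨,⟩-linear r′) (T g) (T u))) ⟩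
      ⟨ r′ , v ⟩ + ⟨ r′ , T u ⟩                       ≡⟨ cong₂ _+_ orth-v (u-span r′ orth-gs) ⟩
      0ℚ                                              ∎

-- `∂ c w` is the orthogonal projection of `z` onto the boundaries of chains on `P`. Orthogonality
-- of the remainder to `∂ c (basis σ)` is, by adjointness, the vanishing of its coboundary at `σ`.
coclosed-remainder : ∀ {P : Subset m → Set} → Decidable P → ∀ c z →
  ∃ λ w → w SupportedOn P × (∀ σ → P σ → δ c (λ τ → z τ - ∂ c w τ) σ ≡ 0ℚ)
coclosed-remainder {m} {P} P? c z =
  let w , w-P , _ , orth = project (∂-linear c) generators generators-P z
  in w , w-P , λ σ Pσ → begin
    δ c (λ τ → z τ - ∂ c w τ) σ               ≡⟨ sym (⟨,basis⟩ (δ c (λ τ → z τ - ∂ c w τ)) σ) ⟩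
    ⟨ δ c (λ τ → z τ - ∂ c w τ) , basis σ ⟩   ≡⟨ ⟨,⟩-comm _ (basis σ) ⟩
    ⟨ basis σ , δ c (λ τ → z τ - ∂ c w τ) ⟩   ≡⟨ sym (adjoint c (basis σ) _) ⟩
    ⟨ ∂ c (basis σ) , (λ τ → z τ - ∂ c w τ) ⟩ ≡⟨ ⟨,⟩-comm (∂ c (basis σ)) _ ⟩
    ⟨ (λ τ → z τ - ∂ c w τ) , ∂ c (basis σ) ⟩ ≡⟨ All.lookup (All-map⁻ orth) (∈-filter⁺ P? (∈-subsets σ) Pσ) ⟩
    0ℚ                                        ∎
  where
  open ≡-Reasoning

  generators : List (Chain m)
  generators = List.map basis (List.filter P? (subsets m))

  basis-P : ∀ {σ} → P σ → basis σ SupportedOn P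
  basis-P {σ} Pσ τ ¬Pτ with basis σ τ ≟ 0ℚ
  ... | yes b≡0 = b≡0
  ... | no  b≢0 = contradiction (subst P (sym (basis-support σ τ b≢0)) Pσ) ¬Pτ

  generators-P : All (_SupportedOn P) generators
  generators-P = All-map⁺ (All.map basis-P (all-filter P? (subsets m)))

-- Acyclicity of the matching complex

∈-remove⁺ : ∀ {σ : Subset m} {w x} → x ∈ σ → x ≢ w → x ∈ σ [ w ]≔ outside
∈-remove⁺ {σ = σ} {w} {x} x∈σ x≢w = []≔-minimal σ x w x≢w x∈σ

∈-remove⁻ : ∀ (σ : Subset m) w {x} → x ∈ σ [ w ]≔ outside → x ∈ σ × x ≢ w
∈-remove⁻ (s ∷ σ) zero    (there x∈σ) = there x∈σ , λ ()
∈-remove⁻ (s ∷ σ) (suc w) here        = here , λ ()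
∈-remove⁻ (s ∷ σ) (suc w) (there x∈)  =
  let x∈σ , x≢w = ∈-remove⁻ σ w x∈ in there x∈σ , λ { refl → x≢w refl }

∣remove∣ : ∀ {σ : Subset m} {w} → w ∈ σ → ∣ σ ∣ ≡ suc ∣ σ [ w ]≔ outside ∣
∣remove∣                     here        = refl
∣remove∣ {σ = inside  ∷ σ}   (there w∈σ) = cong suc (∣remove∣ w∈σ)
∣remove∣ {σ = outside ∷ σ}   (there w∈σ) = ∣remove∣ w∈σ

⊆-insert : ∀ (σ : Subset m) w → σ ⊆ σ [ w ]≔ inside
⊆-insert (s ∷ σ) zero    here        = here
⊆-insert (s ∷ σ) zero    (there x∈σ) = there x∈σ
⊆-insert (s ∷ σ) (suc w) here        = here
⊆-insert (s ∷ σ) (suc w) (there x∈σ) = there (⊆-insert σ w x∈σ)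

∣insert∣ : ∀ (σ : Subset m) w → w ∉ σ → ∣ σ [ w ]≔ inside ∣ ≡ suc ∣ σ ∣
∣insert∣ (inside  ∷ σ) zero    w∉σ = contradiction here w∉σ
∣insert∣ (outside ∷ σ) zero    w∉σ = refl
∣insert∣ (inside  ∷ σ) (suc w) w∉σ = cong suc (∣insert∣ σ w (w∉σ ∘ there))
∣insert∣ (outside ∷ σ) (suc w) w∉σ = ∣insert∣ σ w (w∉σ ∘ there)

∉⇒lookup : ∀ {σ : Subset m} {w} → w ∉ σ → lookup σ w ≡ outside
∉⇒lookup {σ = σ} {w} w∉σ with lookup σ w in eq
... | outside = refl
... | inside  = contradiction (lookup⇒[]= w σ eq) w∉σ

χ-∈ : ∀ {σ : Subset m} {w} → w ∈ σ → χ (lookup σ w) ≡ 1ℚ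
χ-∈ w∈σ = cong χ ([]=⇒lookup w∈σ)

χ-∉ : ∀ {σ : Subset m} {w} → w ∉ σ → χ (lookup σ w) ≡ 0ℚ
χ-∉ w∉σ = cong χ (∉⇒lookup w∉σ)

-- Unions of indexed families and their sizes

⋃ : (Fin n → Subset m) → Subset n → Subset m
⋃ p []            = ⊥
⋃ p (outside ∷ I) = ⋃ (p ∘ suc) I
⋃ p (inside  ∷ I) = p zero ∪ ⋃ (p ∘ suc) I

∈-⋃⁺ : ∀ (p : Fin n → Subset m) {I i x} → i ∈ I → x ∈ p i → x ∈ ⋃ p I
∈-⋃⁺ p                     here        x∈p = x∈p∪q⁺ (inj₁ x∈p)
∈-⋃⁺ p {I = outside ∷ I}   (there i∈I) x∈p = ∈-⋃⁺ (p ∘ suc) i∈I x∈p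
∈-⋃⁺ p {I = inside  ∷ I}   (there i∈I) x∈p = x∈p∪q⁺ (inj₂ (∈-⋃⁺ (p ∘ suc) i∈I x∈p))

∈-⋃⁻ : ∀ (p : Fin n → Subset m) I {x} → x ∈ ⋃ p I → ∃ λ i → i ∈ I × x ∈ p i
∈-⋃⁻ p []            x∈ = contradiction x∈ ∉⊥
∈-⋃⁻ p (outside ∷ I) x∈ = let i , i∈I , x∈p = ∈-⋃⁻ (p ∘ suc) I x∈ in suc i , there i∈I , x∈p
∈-⋃⁻ p (inside  ∷ I) x∈ with x∈p∪q⁻ (p zero) (⋃ (p ∘ suc) I) x∈
... | inj₁ x∈p = zero , here , x∈p
... | inj₂ x∈⋃ = let i , i∈I , x∈p = ∈-⋃⁻ (p ∘ suc) I x∈⋃ in suc i , there i∈I , x∈p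

∣p∪q∣≤∣p∣+∣q∣ : ∀ (p q : Subset m) → ∣ p ∪ q ∣ ℕ.≤ ∣ p ∣ ℕ.+ ∣ q ∣
∣p∪q∣≤∣p∣+∣q∣ []            []            = z≤n
∣p∪q∣≤∣p∣+∣q∣ (outside ∷ p) (outside ∷ q) = ∣p∪q∣≤∣p∣+∣q∣ p q
∣p∪q∣≤∣p∣+∣q∣ (outside ∷ p) (inside  ∷ q) = ℕ.≤-trans (s≤s (∣p∪q∣≤∣p∣+∣q∣ p q)) (ℕ.≤-reflexive (sym (ℕ.+-suc ∣ p ∣ ∣ q ∣)))
∣p∪q∣≤∣p∣+∣q∣ (inside  ∷ p) (outside ∷ q) = s≤s (∣p∪q∣≤∣p∣+∣q∣ p q)
∣p∪q∣≤∣p∣+∣q∣ (inside  ∷ p) (inside  ∷ q) = s≤s (ℕ.≤-trans (∣p∪q∣≤∣p∣+∣q∣ p q) (ℕ.+-monoʳ-≤ ∣ p ∣ (ℕ.n≤1+n ∣ q ∣)))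

disjoint⇒∣p∣+∣q∣≡∣p∪q∣ : ∀ (p q : Subset m) → Empty (p ∩ q) → ∣ p ∣ ℕ.+ ∣ q ∣ ≡ ∣ p ∪ q ∣
disjoint⇒∣p∣+∣q∣≡∣p∪q∣ []            []            _ = refl
disjoint⇒∣p∣+∣q∣≡∣p∪q∣ (outside ∷ p) (outside ∷ q) p∩q≡∅ = disjoint⇒∣p∣+∣q∣≡∣p∪q∣ p q λ (x , x∈) → p∩q≡∅ (suc x , there x∈)
disjoint⇒∣p∣+∣q∣≡∣p∪q∣ (outside ∷ p) (inside  ∷ q) p∩q≡∅ =
  trans (ℕ.+-suc ∣ p ∣ ∣ q ∣) (cong suc (disjoint⇒∣p∣+∣q∣≡∣p∪q∣ p q λ (x , x∈) → p∩q≡∅ (suc x , there x∈)))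
disjoint⇒∣p∣+∣q∣≡∣p∪q∣ (inside  ∷ p) (outside ∷ q) p∩q≡∅ = cong suc (disjoint⇒∣p∣+∣q∣≡∣p∪q∣ p q λ (x , x∈) → p∩q≡∅ (suc x , there x∈))
disjoint⇒∣p∣+∣q∣≡∣p∪q∣ (inside  ∷ p) (inside  ∷ q) p∩q≡∅ = contradiction (zero , here) p∩q≡∅

∣⋃∣≤ : ∀ (p : Fin n → Subset m) {q} → (∀ i → ∣ p i ∣ ℕ.≤ q) → ∀ I → ∣ ⋃ p I ∣ ℕ.≤ ∣ I ∣ ℕ.* q
∣⋃∣≤ {m = m} p p≤q []            = ℕ.≤-reflexive (∣⊥∣≡0 m)
∣⋃∣≤         p p≤q (outside ∷ I) = ∣⋃∣≤ (p ∘ suc) (p≤q ∘ suc) I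
∣⋃∣≤         p p≤q (inside  ∷ I) = ℕ.≤-trans (∣p∪q∣≤∣p∣+∣q∣ (p zero) _) (ℕ.+-mono-≤ (p≤q zero) (∣⋃∣≤ (p ∘ suc) (p≤q ∘ suc) I))

∣⋃∣≥ : ∀ (p : Fin n → Subset m) {q} → (∀ i j → i ≢ j → Empty (p i ∩ p j)) → (∀ i → q ℕ.≤ ∣ p i ∣) →
       ∀ I → ∣ I ∣ ℕ.* q ℕ.≤ ∣ ⋃ p I ∣
∣⋃∣≥ p disj q≤p []            = z≤n
∣⋃∣≥ p disj q≤p (outside ∷ I) = ∣⋃∣≥ (p ∘ suc) (λ i j i≢j → disj (suc i) (suc j) λ { refl → i≢j refl }) (q≤p ∘ suc) I
∣⋃∣≥ p disj q≤p (inside  ∷ I) = ℕ.≤-trans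
  (ℕ.+-mono-≤ (q≤p zero) (∣⋃∣≥ (p ∘ suc) (λ i j i≢j → disj (suc i) (suc j) λ { refl → i≢j refl }) (q≤p ∘ suc) I))
  (ℕ.≤-reflexive (disjoint⇒∣p∣+∣q∣≡∣p∪q∣ (p zero) _ λ (x , x∈) →
    let x∈p₀ , x∈⋃ = x∈p∩q⁻ (p zero) _ x∈
        i , _ , x∈pᵢ = ∈-⋃⁻ (p ∘ suc) I x∈⋃
    in disj zero (suc i) (λ ()) (x , x∈p∩q⁺ (x∈p₀ , x∈pᵢ))))

-- The terms lost by restricting the boundary to `A` evaluate `f` at sets that leave `A`. The norm
-- argument works with `∂ A`, while cycles and fillings are stated with `∂ ⊤`.
∂-mask : ∀ {A : Subset m} {f} → f SupportedOn (_⊆ A) → ∂ A f ≗ ∂ ⊤ f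
∂-mask {A = A} {f} f-A σ = ∂-local A ⊤ f f σ mask
  where
  mask : ∀ w → w ∉ σ → χ (lookup A w) * f (σ [ w ]≔ inside) ≡ χ (lookup ⊤ w) * f (σ [ w ]≔ inside)
  mask w w∉σ with w ∈? A
  ... | yes w∈A = cong (_* f (σ [ w ]≔ inside)) (trans (χ-∈ w∈A) (sym (χ-∈ {w = w} ∈⊤)))
  ... | no  w∉A =
      trans (cong (χ (lookup A w) *_) f≡0) (trans (trans (ℚ.*-zeroʳ (χ (lookup A w))) (sym (ℚ.*-zeroʳ (χ (lookup ⊤ w))))) (cong (χ (lookup ⊤ w) *_) (sym f≡0)))
    where f≡0 = f-A (σ [ w ]≔ inside) λ ⊆A → w∉A (⊆A ([]≔-updates σ w))

-- Inequalities for natural multiples and finite sums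

ι-nonNeg : ∀ n → 0ℚ ≤ ι n
ι-nonNeg zero    = ℚ.≤-refl
ι-nonNeg (suc n) = ℚ.+-mono-≤ (ℚ.nonNegative⁻¹ 1ℚ) (ι-nonNeg n)

ι-mono-≤ : ∀ {a b} → a ℕ.≤ b → ι a ≤ ι b
ι-mono-≤ {b = b} z≤n = ι-nonNeg b
ι-mono-≤ (s≤s a≤b)   = ℚ.+-monoʳ-≤ 1ℚ (ι-mono-≤ a≤b)

ι-+ : ∀ a b → ι (a ℕ.+ b) ≡ ι a + ι b
ι-+ zero    b = sym (ℚ.+-identityˡ (ι b))
ι-+ (suc a) b = trans (cong (1ℚ +_) (ι-+ a b)) (sym (ℚ.+-assoc 1ℚ (ι a) (ι b)))

ι-* : ∀ a b → ι (a ℕ.* b) ≡ ι a * ι b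
ι-* zero    b = sym (ℚ.*-zeroˡ (ι b))
ι-* (suc a) b = trans (ι-+ b (a ℕ.* b)) (trans (cong (ι b +_) (ι-* a b))
  (solve 2 (λ a b → b :+ a :* b := (con 1ℚ :+ a) :* b) refl (ι a) (ι b)))

ι*-mono-≤ : ∀ {a b x} → 0ℚ ≤ x → a ℕ.≤ b → ι a * x ≤ ι b * x
ι*-mono-≤ {x = x} 0≤x a≤b = ℚ.*-monoʳ-≤-nonNeg x {{nonNegative 0≤x}} (ι-mono-≤ a≤b)

ι*-monoʳ-≤ : ∀ a {x y} → x ≤ y → ι a * x ≤ ι a * y
ι*-monoʳ-≤ a x≤y = ℚ.*-monoˡ-≤-nonNeg (ι a) {{nonNegative (ι-nonNeg a)}} x≤y

-- The gap between `a` and `b` leaves at least one full copy of `x` after `ι a * x` is cancelled.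
ι*≤⇒≤0 : ∀ {a b x} → a ℕ.< b → 0ℚ ≤ x → ι b * x ≤ ι a * x → x ≤ 0ℚ
ι*≤⇒≤0 {a} {b} {x} a<b 0≤x ιb*x≤ιa*x = begin
  x                               ≡⟨ solve 2 (λ a x → x := (con 1ℚ :+ a) :* x :- a :* x) refl (ι a) x ⟩
  ι (suc a) * x - ι a * x         ≤⟨ ℚ.+-monoˡ-≤ (- (ι a * x)) (ι*-mono-≤ 0≤x a<b) ⟩
  ι b * x - ι a * x               ≤⟨ ℚ.+-monoˡ-≤ (- (ι a * x)) ιb*x≤ιa*x ⟩
  ι a * x - ι a * x               ≡⟨ ℚ.+-inverseʳ (ι a * x) ⟩
  0ℚ                              ∎
  where open ℚ.≤-Reasoning

Σ-mono-≤ : ∀ {f g : Fin n → ℚ} → (∀ i → f i ≤ g i) → Σ f ≤ Σ g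
Σ-mono-≤ {zero}  f≤g = ℚ.≤-refl
Σ-mono-≤ {suc n} f≤g = ℚ.+-mono-≤ (f≤g zero) (Σ-mono-≤ (f≤g ∘ suc))

Σ-nonNeg : ∀ {f : Fin n → ℚ} → (∀ i → 0ℚ ≤ f i) → 0ℚ ≤ Σ f
Σ-nonNeg {zero}  0≤f = ℚ.≤-refl
Σ-nonNeg {suc n} 0≤f = ℚ.+-mono-≤ (0≤f zero) (Σ-nonNeg (0≤f ∘ suc))

term≤Σ : ∀ {f : Fin n → ℚ} → (∀ i → 0ℚ ≤ f i) → ∀ i → f i ≤ Σ f
term≤Σ {f =
  f} 0≤f zero    = ℚ.≤-trans (ℚ.≤-reflexive (sym (ℚ.+-identityʳ (f zero)))) (ℚ.+-monoʳ-≤ (f zero) (Σ-nonNeg (0≤f ∘ suc)))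
term≤Σ {f =
  f} 0≤f (suc i) = ℚ.≤-trans (ℚ.≤-reflexive (sym (ℚ.+-identityˡ (f (suc i))))) (ℚ.+-mono-≤ (0≤f zero) (term≤Σ (0≤f ∘ suc) i))

Σ-scale : ∀ a (f : Fin n → ℚ) → Σ (λ i → a * f i) ≡ a * Σ f
Σ-scale {zero}  a f = sym (ℚ.*-zeroʳ a)
Σ-scale {suc n} a f = trans (cong (a * f zero +_) (Σ-scale a (f ∘ suc))) (sym (ℚ.*-distribˡ-+ a (f zero) (Σ (f ∘ suc))))

Σ-commute : ∀ {ℓ : Chain m → ℚ} → Linear ℓ → ∀ (F : Fin n → Chain m) → ℓ (λ σ → Σ (λ i → F i σ)) ≡ Σ (λ i → ℓ (F i))
Σ-commute {n = zero}          lin F = ℓ-zero lin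
Σ-commute {n = suc n} {ℓ = ℓ} lin F = begin
  ℓ (λ σ → F zero σ + Σ (λ i → F (suc i) σ))
    ≡⟨ ℓ-cong lin (λ σ → cong (_+ Σ (λ i → F (suc i) σ)) (sym (ℚ.*-identityˡ (F zero σ)))) ⟩
  ℓ (λ σ → 1ℚ * F zero σ + Σ (λ i → F (suc i) σ))  ≡⟨ ℓ-scale-add lin 1ℚ (F zero) _ ⟩
  1ℚ * ℓ (F zero) + ℓ (λ σ → Σ (λ i → F (suc i) σ))
    ≡⟨ cong₂ _+_ (ℚ.*-identityˡ (ℓ (F zero))) (Σ-commute lin (F ∘ suc)) ⟩
  ℓ (F zero) + Σ (λ i → ℓ (F (suc i)))             ∎
  where open ≡-Reasoning

Σ-χ : ∀ (c : Subset n) x → Σ (λ i → χ (lookup c i) * x) ≡ ι ∣ c ∣ * x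
Σ-χ []            x = sym (ℚ.*-zeroˡ x)
Σ-χ (outside ∷ c) x = trans (cong₂ _+_ (ℚ.*-zeroˡ x) (Σ-χ c x)) (ℚ.+-identityˡ (ι ∣ c ∣ * x))
Σ-χ (inside  ∷ c) x = trans (cong (1ℚ * x +_) (Σ-χ c x)) (sym (ℚ.*-distribʳ-+ x 1ℚ (ι ∣ c ∣)))

-- The norm identity with its nonnegative boundary term dropped.
∥δ∥²≤ : ∀ (c : Subset m) f → ∥ δ c f ∥² ≤ ι ∣ c ∣ * ∥ f ∥²
∥δ∥²≤ c f = begin
  ∥ δ c f ∥²                ≡⟨ sym (ℚ.+-identityˡ ∥ δ c f ∥²) ⟩
  0ℚ + ∥ δ c f ∥²           ≤⟨ ℚ.+-monoˡ-≤ ∥ δ c f ∥² (∥∥²-nonNeg (∂ c f)) ⟩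
  ∥ ∂ c f ∥² + ∥ δ c f ∥²   ≡⟨ ∥∂∥²+∥δ∥² c f ⟩
  ι ∣ c ∣ * ∥ f ∥²          ∎
  where open ℚ.≤-Reasoning

χ-square : ∀ s x → χ s * x * (χ s * x) ≡ χ s * (x * x)
χ-square outside x = solve 1 (λ x → con 0ℚ :* x :* (con 0ℚ :* x) := con 0ℚ :* (x :* x)) refl x
χ-square inside  x = solve 1 (λ x → con 1ℚ :* x :* (con 1ℚ :* x) := con 1ℚ :* (x :* x)) refl x

-- Turns the list count in `degree` into the size of the subset `star p`.
∣tabulate∣ : ∀ {A : Set} {P : A → Set} (P? : Decidable P) (f : Fin m → A) →
             ∣ tabulate (λ i → does (P? (f i))) ∣ ≡ List.length (List.filter P? (List.tabulate f))
∣tabulate∣ {zero}  P? f = refl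
∣tabulate∣ {suc m} P? f with does (P? (f zero))
... | true  = cong suc (∣tabulate∣ P? (f ∘ suc))
... | false = ∣tabulate∣ P? (f ∘ suc)

-- Vanishing of harmonic chains on matchings

module MatchingComplex (G : Hypergraph) where

  star : Fin (#V G) → Subset (#E G)
  star p = tabulate (λ e → does (p ∈? edge G e))

  ∈-star⁺ : ∀ {p e} → p ∈ edge G e → e ∈ star p
  ∈-star⁺ {p} {e} p∈e = lookup⇒[]= e (star p) (trans (lookup∘tabulate _ e) (dec-true (p ∈? edge G e) p∈e))

  ∈-star⁻ : ∀ {p e} → e ∈ star p → p ∈ edge G e
  ∈-star⁻ {p} {e} e∈ with p ∈? edge G e | trans (sym (lookup∘tabulate (λ e → does (p ∈? edge G e)) e)) ([]=⇒lookup e∈)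
  ... | yes p∈e | _  = p∈e

  ∣star∣≤maxDegree : ∀ p → ∣ star p ∣ ℕ.≤ maxDegree G
  ∣star∣≤maxDegree p = ℕ.≤-trans (ℕ.≤-reflexive (∣tabulate∣ (λ e → p ∈? edge G e) (λ e → e)))
    (All.lookup (xs≤max 0 (List.map (degree G) (List.allFin (#V G)))) (∈-map⁺ (degree G) (∈-allFin p)))

  -- Failure to be a matching in positive form. The shared vertex `p` is kept as data because it
  -- selects the star along which coboundaries are compared.
  Conflict : Subset (#E G) → Set
  Conflict σ = ∃ λ p → ∃ λ e → ∃ λ f → e ∈ σ × f ∈ σ × e ≢ f × p ∈ edge G e × p ∈ edge G f

  conflict? : Decidable Conflict
  conflict? σ = any? λ p → any? λ e → any? λ f →
    (e ∈? σ) ×-dec (f ∈? σ) ×-dec ¬? (e ≟ᶠ f) ×-dec (p ∈? edge G e) ×-dec (p ∈? edge G f)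

  ¬conflict⇒matching : ∀ {σ} → ¬ Conflict σ → IsMatching G σ
  ¬conflict⇒matching ¬c e f e∈σ f∈σ e≢f (p , p∈) =
    let p∈e , p∈f = x∈p∩q⁻ (edge G e) (edge G f) p∈ in ¬c (p , e , f , e∈σ , f∈σ , e≢f , p∈e , p∈f)

  conflict⇒¬matching : ∀ {σ} → Conflict σ → ¬ IsMatching G σ
  conflict⇒¬matching (p , e , f , e∈σ , f∈σ , e≢f , p∈e , p∈f) matching =
    matching e f e∈σ f∈σ e≢f (p , x∈p∩q⁺ (p∈e , p∈f))

  matching? : Decidable (IsMatching G)
  matching? σ = map′ ¬conflict⇒matching (λ matching c → conflict⇒¬matching c matching) (¬? (conflict? σ))

  matching-⊆ : ∀ {σ τ} → σ ⊆ τ → IsMatching G τ → IsMatching G σ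
  matching-⊆ = down-closed (matchingComplex G)

  -- An upper bound on the size takes the place of a grading: a chain may mix sizes, its boundary
  -- lowers the bound by one and a filling raises it by one.
  record Face (A : Subset (#E G)) (k : ℕ) (σ : Subset (#E G)) : Set where
    constructor face
    field
      matching : IsMatching G σ
      within   : σ ⊆ A
      size     : ∣ σ ∣ ℕ.≤ k

  face? : ∀ A k → Decidable (Face A k)
  face? A k σ with matching? σ | σ ⊆? A | ∣ σ ∣ ℕ.≤? k
  ... | yes mat | yes σ⊆A | yes σ≤k = yes (face mat σ⊆A σ≤k)
  ... | no ¬mat | _       | _       = no (¬mat ∘ Face.matching)
  ... | _       | no σ⊈A  | _       = no λ σ-face → σ⊈A (Face.within σ-face)
  ... | _       | _       | no σ≰k  = no (σ≰k ∘ Face.size)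

  ∂-face : ∀ {A k f} c → f SupportedOn Face A (suc k) → ∂ c f SupportedOn Face A k
  ∂-face {f = f} c f-face σ ¬face = ∂-vanish c f σ λ w w∉σ → f-face (σ [ w ]≔ inside) λ (face mat ⊆A ≤k) →
    ¬face (face (matching-⊆ (⊆-insert σ w) mat) (λ x∈ → ⊆A (⊆-insert σ w x∈))
                (ℕ.≤-pred (ℕ.≤-trans (ℕ.≤-reflexive (sym (∣insert∣ σ w w∉σ))) ≤k)))

  module _ {r : ℕ} (uniform : Uniform r G) {A : Subset (#E G)} {k : ℕ} where

    -- Coclosedness is assumed on faces only. At sets with a conflict `δ A y` may be nonzero, and
    -- these values are what the estimates below control.
    module Harmonic {y : Chain (#E G)} (y-face : y SupportedOn Face A k)
                    (δy≡0 : ∀ σ → Face A (suc k) σ → δ A y σ ≡ 0ℚ) where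

      yₚ : Fin (#V G) → Chain (#E G)
      yₚ p σ = χ (lookup (⋃ (edge G) σ) p) * y σ

      -- If two edges of σ meet at p, then every face σ − w with w off p
      -- still contains both of them and is not a matching.
      δ-at-conflict : ∀ σ → σ ⊆ A → ((p , _) : Conflict σ) → δ A y σ ≡ δ (star p) (yₚ p) σ
      δ-at-conflict σ σ⊆A (p , e , f , e∈σ , f∈σ , e≢f , p∈e , p∈f) = δ-local A (star p) y (yₚ p) σ eq
        where
        eq : ∀ w → w ∈ σ → χ (lookup A w) * y (σ [ w ]≔ outside) ≡ χ (lookup (star p) w) * yₚ p (σ [ w ]≔ outside)
        eq w w∈σ with p ∈? edge G w
        ... | no p∉w = trans (cong (χ (lookup A w) *_) y≡0) (trans (ℚ.*-zeroʳ (χ (lookup A w)))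
            (sym (trans (cong (_* yₚ p (σ [ w ]≔ outside)) (χ-∉ {w = w} (p∉w ∘ ∈-star⁻))) (ℚ.*-zeroˡ (yₚ p (σ [ w ]≔ outside))))))
          where
          y≡0 : y (σ [ w ]≔ outside) ≡ 0ℚ
          y≡0 = y-face _ λ (face mat _ _) → conflict⇒¬matching
            (p , e , f , ∈-remove⁺ e∈σ (λ { refl → p∉w p∈e }) , ∈-remove⁺ f∈σ (λ { refl → p∉w p∈f }) , e≢f , p∈e , p∈f) mat
        ... | yes p∈w = trans (cong (_* y τ) (trans (χ-∈ (σ⊆A w∈σ)) (sym (χ-∈ (∈-star⁺ p∈w)))))
            (cong (χ (lookup (star p) w) *_) (trans (sym (ℚ.*-identityˡ (y τ))) (cong (_* y τ) (sym (χ-∈ covered)))))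
          where
          τ = σ [ w ]≔ outside
          -- `w` equals at most one of `e` and `f`; the other survives in `τ` and covers `p`.
          covered : p ∈ ⋃ (edge G) τ
          covered with e ≟ᶠ w
          ... | yes refl = ∈-⋃⁺ (edge G) (∈-remove⁺ f∈σ (e≢f ∘ sym)) p∈f
          ... | no  e≢w  = ∈-⋃⁺ (edge G) (∈-remove⁺ e∈σ e≢w) p∈e

      -- A nonzero term needs `w` in `A` and `σ` without `w` a face. Then `σ` lies in `A` and has at
      -- most `suc k` elements, so without a conflict it is itself a face, where coclosedness
      -- applies.
      δ-off-conflict : ∀ σ → ¬ (σ ⊆ A × Conflict σ) → δ A y σ ≡ 0ℚ
      δ-off-conflict σ ¬c with face? A (suc k) σ
      ... | yes σ-face = δy≡0 σ σ-face
      ... | no  ¬face  = δ-vanish A y σ vanish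
        where
        vanish : ∀ w → w ∈ σ → χ (lookup A w) * y (σ [ w ]≔ outside) ≡ 0ℚ
        vanish w w∈σ with w ∈? A
        ... | no  w∉A = trans (cong (_* y (σ [ w ]≔ outside)) (χ-∉ w∉A)) (ℚ.*-zeroˡ (y (σ [ w ]≔ outside)))
        ... | yes w∈A = trans (cong (χ (lookup A w) *_) (y-face _ ¬face′)) (ℚ.*-zeroʳ (χ (lookup A w)))
          where
          ¬face′ : ¬ Face A k (σ [ w ]≔ outside)
          ¬face′ (face _ τ⊆A τ≤k) = ¬face (face (¬conflict⇒matching λ c → ¬c (σ⊆A , c)) σ⊆A
              (ℕ.≤-trans (ℕ.≤-reflexive (∣remove∣ w∈σ)) (s≤s τ≤k)))
            where
            σ⊆A : σ ⊆ A
            σ⊆A {x} x∈σ with x ≟ᶠ w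
            ... | yes refl = w∈A
            ... | no  x≢w  = τ⊆A (∈-remove⁺ x∈σ x≢w)

      -- At a conflict the square is a single summand, the one for the shared vertex; elsewhere it
      -- is zero. One conflict per set suffices.
      δ²≤ : ∀ σ → δ A y σ * δ A y σ ≤ Σ (λ p → δ (star p) (yₚ p) σ * δ (star p) (yₚ p) σ)
      δ²≤ σ with (σ ⊆? A) ×-dec conflict? σ
      ... | yes (σ⊆A , c) = ℚ.≤-trans (ℚ.≤-reflexive (cong (λ x → x * x) (δ-at-conflict σ σ⊆A c)))
              (term≤Σ (λ p → square-nonNeg (δ (star p) (yₚ p) σ)) (proj₁ c))
      ... | no ¬c = ℚ.≤-trans (ℚ.≤-reflexive (cong (λ x → x * x) (δ-off-conflict σ ¬c)))
              (Σ-nonNeg λ p → square-nonNeg (δ (star p) (yₚ p) σ))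

      Σ-yₚ² : ∀ σ → Σ (λ p → yₚ p σ * yₚ p σ) ≡ ι ∣ ⋃ (edge G) σ ∣ * (y σ * y σ)
      Σ-yₚ² σ = trans (sum-cong-≗ (λ p → χ-square (lookup (⋃ (edge G) σ) p) (y σ))) (Σ-χ (⋃ (edge G) σ) (y σ * y σ))

      -- The sum counts `y σ * y σ` once per covered vertex, and at most `k` edges of size `r` cover
      -- at most `k ℕ.* r` vertices.
      Σ-yₚ²≤ : ∀ σ → Σ (λ p → yₚ p σ * yₚ p σ) ≤ ι (k ℕ.* r) * (y σ * y σ)
      Σ-yₚ²≤ σ with face? A k σ
      ... | yes (face _ _ σ≤k) = ℚ.≤-trans (ℚ.≤-reflexive (Σ-yₚ² σ)) (ι*-mono-≤ (square-nonNeg (y σ))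
              (ℕ.≤-trans (∣⋃∣≤ (edge G) (ℕ.≤-reflexive ∘ uniform) σ) (ℕ.*-monoˡ-≤ r σ≤k)))
      ... | no ¬face = ℚ.≤-reflexive (trans (Σ-yₚ² σ) (trans (y²≡0 (ι ∣ ⋃ (edge G) σ ∣)) (sym (y²≡0 (ι (k ℕ.* r))))))
        where
        y²≡0 : ∀ a → a * (y σ * y σ) ≡ 0ℚ
        y²≡0 a = trans (cong (λ x → a * (x * x)) (y-face σ ¬face)) (ℚ.*-zeroʳ a)

      ∥δ∥²≤Δrk : ∥ δ A y ∥² ≤ ι (maxDegree G ℕ.* (k ℕ.* r)) * ∥ y ∥²
      ∥δ∥²≤Δrk = begin
        ∥ δ A y ∥²                                                    ≤⟨ ∑-mono-≤ δ²≤ ⟩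
        ∑ (λ σ → Σ (λ p → δ (star p) (yₚ p) σ * δ (star p) (yₚ p) σ))
          ≡⟨ Σ-commute ∑-linear (λ p σ → δ (star p) (yₚ p) σ * δ (star p) (yₚ p) σ) ⟩
        Σ (λ p → ∥ δ (star p) (yₚ p) ∥²)
          ≤⟨ Σ-mono-≤ (λ p → ℚ.≤-trans (∥δ∥²≤ (star p) (yₚ p)) (ι*-mono-≤ (∥∥²-nonNeg (yₚ p)) (∣star∣≤maxDegree p))) ⟩
        Σ (λ p → ι (maxDegree G) * ∥ yₚ p ∥²)
          ≡⟨ Σ-scale (ι (maxDegree G)) (λ p → ∥ yₚ p ∥²) ⟩
        ι (maxDegree G) * Σ (λ p → ∥ yₚ p ∥²)
          ≡⟨ cong (ι (maxDegree G) *_) (sym (Σ-commute ∑-linear (λ p σ → yₚ p σ * yₚ p σ))) ⟩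
        ι (maxDegree G) * ∑ (λ σ → Σ (λ p → yₚ p σ * yₚ p σ))
          ≤⟨ ι*-monoʳ-≤ (maxDegree G) (∑-mono-≤ Σ-yₚ²≤) ⟩
        ι (maxDegree G) * ∑ (λ σ → ι (k ℕ.* r) * (y σ * y σ))
          ≡⟨ cong (ι (maxDegree G) *_) (ℓ-scale ∑-linear (ι (k ℕ.* r)) (λ σ → y σ * y σ)) ⟩
        ι (maxDegree G) * (ι (k ℕ.* r) * ∥ y ∥²)
          ≡⟨ sym (ℚ.*-assoc (ι (maxDegree G)) (ι (k ℕ.* r)) ∥ y ∥²) ⟩
        ι (maxDegree G) * ι (k ℕ.* r) * ∥ y ∥²
          ≡⟨ cong (_* ∥ y ∥²) (sym (ι-* (maxDegree G) (k ℕ.* r))) ⟩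
        ι (maxDegree G ℕ.* (k ℕ.* r)) * ∥ y ∥²                        ∎
        where open ℚ.≤-Reasoning

      harmonic⇒≡0 : maxDegree G ℕ.* (k ℕ.* r) ℕ.< ∣ A ∣ → (∀ σ → ∂ A y σ ≡ 0ℚ) → ∀ σ → y σ ≡ 0ℚ
      harmonic⇒≡0 Δrk<A ∂y≡0 = ∥∥²-definite y (ι*≤⇒≤0 Δrk<A (∥∥²-nonNeg y) (ℚ.≤-trans (ℚ.≤-reflexive norm) ∥δ∥²≤Δrk))
        where
        open ≡-Reasoning
        norm : ι ∣ A ∣ * ∥ y ∥² ≡ ∥ δ A y ∥²
        norm = begin
          ι ∣ A ∣ * ∥ y ∥²          ≡⟨ sym (∥∂∥²+∥δ∥² A y) ⟩
          ∥ ∂ A y ∥² + ∥ δ A y ∥²   ≡⟨ cong (_+ ∥ δ A y ∥²) (ℓ-vanish ∑-linear λ σ → cong (λ x → x * x) (∂y≡0 σ)) ⟩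
          0ℚ + ∥ δ A y ∥²           ≡⟨ ℚ.+-identityˡ ∥ δ A y ∥² ⟩
          ∥ δ A y ∥²                ∎

    -- Subtracting from `z` its projection onto boundaries of faces leaves a chain that is closed,
    -- and coclosed on faces. It is therefore zero, so the projection is all of `z`.
    acyclic : maxDegree G ℕ.* (k ℕ.* r) ℕ.< ∣ A ∣ → ∀ {z} → z SupportedOn Face A k → (∀ σ → ∂ ⊤ z σ ≡ 0ℚ) →
              ∃ λ w → w SupportedOn Face A (suc k) × ∂ ⊤ w ≗ z
    acyclic Δrk<A {z} z-face ∂z≡0 =
      let w , w-face , δy≡0 = coclosed-remainder (face? A (suc k)) A z

          ∂w-face : ∂ A w SupportedOn Face A k
          ∂w-face = ∂-face A w-face

          y-face : (λ σ → z σ - ∂ A w σ) SupportedOn Face A k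
          y-face σ ¬face = cong₂ _-_ (z-face σ ¬face) (∂w-face σ ¬face)

          ∂y≡0 : ∀ σ → ∂ A (λ σ → z σ - ∂ A w σ) σ ≡ 0ℚ
          ∂y≡0 σ = trans (ℓ-sub (∂-linear A σ) z (∂ A w))
            (cong₂ _-_ (trans (∂-mask (λ τ τ⊈A → z-face τ (τ⊈A ∘ Face.within)) σ) (∂z≡0 σ)) (∂∂≡0 A w σ))

          y≡0 = Harmonic.harmonic⇒≡0 y-face δy≡0 Δrk<A ∂y≡0
      in w , w-face , λ σ → begin
        ∂ ⊤ w σ                        ≡⟨ sym (∂-mask (λ τ τ⊈A → w-face τ (τ⊈A ∘ Face.within)) σ) ⟩
        ∂ A w σ                        ≡⟨ solve 2 (λ z w → w := z :- (z :- w)) refl (z σ) (∂ A w σ) ⟩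
        z σ - (z σ - ∂ A w σ)          ≡⟨ cong (λ x → z σ - x) (y≡0 σ) ⟩
        z σ - 0ℚ                       ≡⟨ ℚ.+-identityʳ (z σ) ⟩
        z σ                            ∎
      where open ≡-Reasoning

-- Vertex maps and colourings

*≡0ˡ : ∀ {x y} → (y ≢ 0ℚ → x ≡ 0ℚ) → x * y ≡ 0ℚ
*≡0ˡ {x} {y} y≢0⇒x≡0 with y ≟ 0ℚ
... | yes y≡0 = trans (cong (x *_) y≡0) (ℚ.*-zeroʳ x)
... | no  y≢0 = trans (cong (_* y) (y≢0⇒x≡0 y≢0)) (ℚ.*-zeroˡ y)

*≢0ˡ : ∀ {x y} → x * y ≢ 0ℚ → x ≢ 0ℚ
*≢0ˡ {y = y} xy≢0 x≡0 = xy≢0 (trans (cong (_* y) x≡0) (ℚ.*-zeroˡ y))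

*≢0ʳ : ∀ {x y} → x * y ≢ 0ℚ → y ≢ 0ℚ
*≢0ʳ {x} xy≢0 y≡0 = xy≢0 (trans (cong (x *_) y≡0) (ℚ.*-zeroʳ x))

support⇒supported : ∀ {f : Chain m} {P : Subset m → Set} → (∀ σ → f σ ≢ 0ℚ → P σ) → f SupportedOn P
support⇒supported {f = f} f-P σ ¬Pσ with f σ ≟ 0ℚ
... | yes f≡0 = f≡0
... | no  f≢0 = contradiction (f-P σ f≢0) ¬Pσ

δ⁅⁆-support : ∀ (u : Fin m) f σ → δ ⁅ u ⁆ f σ ≢ 0ℚ → u ∈ σ × f (σ [ u ]≔ outside) ≢ 0ℚ
δ⁅⁆-support u f σ δ≢0 = u∈σ , λ f≡0 → δ≢0 (δ-vanish ⁅ u ⁆ f σ λ w w∈σ → case w ≟ᶠ u of λ where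
    (yes refl) → trans (cong (χ (lookup ⁅ u ⁆ u) *_) f≡0) (ℚ.*-zeroʳ (χ (lookup ⁅ u ⁆ u)))
    (no  w≢u)  → off w w≢u)
  where
  off : ∀ w → w ≢ u → χ (lookup ⁅ u ⁆ w) * f (σ [ w ]≔ outside) ≡ 0ℚ
  off w w≢u = trans (cong (_* f (σ [ w ]≔ outside)) (χ-∉ (x≢y⇒x∉⁅y⁆ w≢u))) (ℚ.*-zeroˡ (f (σ [ w ]≔ outside)))

  u∈σ : u ∈ σ
  u∈σ with u ∈? σ
  ... | yes u∈σ = u∈σ
  ... | no  u∉σ = contradiction (δ-vanish ⁅ u ⁆ f σ λ w w∈σ → off w λ { refl → u∉σ w∈σ }) δ≢0

∂-basis-⊥ : ∀ σ → ∂ ⊤ (basis {m} ⊥) σ ≡ 0ℚ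
∂-basis-⊥ σ = ∂-vanish ⊤ (basis ⊥) σ λ w _ → support⇒supported {P = _≡ ⊥} (basis-support ⊥) (σ [ w ]≔ inside)
  λ eq → ∉⊥ (subst (w ∈_) eq ([]≔-updates σ w))

basis-⊥-⊥ : ∀ m → basis {m} ⊥ ⊥ ≡ 1ℚ
basis-⊥-⊥ zero    = refl
basis-⊥-⊥ (suc m) = basis-⊥-⊥ m

-- The chain map induced by the vertex map g.
push : Subset n → (Fin n → Fin m) → Chain m
push []            g = basis ⊥
push (outside ∷ I) g = push I (g ∘ suc)
push (inside  ∷ I) g = δ ⁅ g zero ⁆ (push I (g ∘ suc))

push-⊥ : (g : Fin n → Fin m) → push ⊥ g ≡ basis ⊥
push-⊥ {zero}  g = refl
push-⊥ {suc n} g = push-⊥ (g ∘ suc)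

-- The chain map property: `δ ⊤` in the index is the signed sum over the facets of `I`. In the
-- inductive step `anticommutator` with the singleton of `u` produces exactly one copy of `f`, the
-- facet without the head.
∂-push : ∀ I (g : Fin n → Fin m) σ → ∂ ⊤ (push I g) σ ≡ δ ⊤ (λ J → push J g σ) I
∂-push []            g σ = ∂-basis-⊥ σ
∂-push (outside ∷ I) g σ = ∂-push I (g ∘ suc) σ
∂-push (inside  ∷ I) g σ = begin
  ∂ ⊤ (δ ⁅ u ⁆ f) σ
    ≡⟨ solve 2 (λ x y → x := (x :+ y) :- y) refl (∂ ⊤ (δ ⁅ u ⁆ f) σ) (δ ⁅ u ⁆ (∂ ⊤ f) σ) ⟩
  (∂ ⊤ (δ ⁅ u ⁆ f) σ + δ ⁅ u ⁆ (∂ ⊤ f) σ) - δ ⁅ u ⁆ (∂ ⊤ f) σ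
    ≡⟨ cong₂ _-_ (anticommutator ⊤ ⁅ u ⁆ f σ) (δ-linear ⁅ u ⁆ σ .ℓ-cong (∂-push I (g ∘ suc))) ⟩
  ι ∣ ⊤ ∩ ⁅ u ⁆ ∣ * f σ - δ ⁅ u ⁆ (λ τ → δ ⊤ (λ J → push J (g ∘ suc) τ) I) σ
    ≡⟨ cong₂ (λ k y → ι k * f σ - y) (trans (cong ∣_∣ (∩-identityˡ ⁅ u ⁆)) (∣⁅x⁆∣≡1 u))
         (δ-commute (δ-linear ⁅ u ⁆ σ) ⊤ (λ J → push J (g ∘ suc)) I) ⟩
  1ℚ * f σ - δ ⊤ (λ J → δ ⁅ u ⁆ (push J (g ∘ suc)) σ) I ∎
  where
  open ≡-Reasoning
  u = g zero
  f = push I (g ∘ suc)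

∣push∣ : ∀ I (g : Fin n → Fin m) σ → push I g σ ≢ 0ℚ → ∣ σ ∣ ≡ ∣ I ∣
∣push∣ {m = m} []            g σ p≢0 = trans (cong ∣_∣ (basis-support ⊥ σ p≢0)) (∣⊥∣≡0 m)
∣push∣         (outside ∷ I) g σ p≢0 = ∣push∣ I (g ∘ suc) σ p≢0
∣push∣         (inside  ∷ I) g σ p≢0 =
  let u∈σ , q≢0 = δ⁅⁆-support (g zero) _ σ p≢0 in trans (∣remove∣ u∈σ) (cong suc (∣push∣ I (g ∘ suc) _ q≢0))

push-∈⁺ : ∀ I (g : Fin n → Fin m) σ → push I g σ ≢ 0ℚ → ∀ {i} → i ∈ I → g i ∈ σ
push-∈⁺ (outside ∷ I) g σ p≢0 (there i∈I) = push-∈⁺ I (g ∘ suc) σ p≢0 i∈I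
push-∈⁺ (inside  ∷ I) g σ p≢0 here        = proj₁ (δ⁅⁆-support (g zero) _ σ p≢0)
push-∈⁺ (inside  ∷ I) g σ p≢0 (there i∈I) =
  proj₁ (∈-remove⁻ σ (g zero) (push-∈⁺ I (g ∘ suc) _ (proj₂ (δ⁅⁆-support (g zero) _ σ p≢0)) i∈I))

push-∈⁻ : ∀ I (g : Fin n → Fin m) σ → push I g σ ≢ 0ℚ → ∀ {x} → x ∈ σ → ∃ λ i → i ∈ I × g i ≡ x
push-∈⁻ []            g σ p≢0 x∈σ = contradiction (subst (_ ∈_) (basis-support ⊥ σ p≢0) x∈σ) ∉⊥
push-∈⁻ (outside ∷ I) g σ p≢0 x∈σ =
  let i , i∈I , gi≡x = push-∈⁻ I (g ∘ suc) σ p≢0 x∈σ in suc i , there i∈I , gi≡x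
push-∈⁻ (inside  ∷ I) g σ p≢0 {x} x∈σ with x ≟ᶠ g zero
... | yes x≡u = zero , here , sym x≡u
... | no  x≢u =
  let i , i∈I , gi≡x = push-∈⁻ I (g ∘ suc) _ (proj₂ (δ⁅⁆-support (g zero) _ σ p≢0)) (∈-remove⁺ x∈σ x≢u)
  in suc i , there i∈I , gi≡x

-- Creating the same element twice gives zero, so a nonzero coefficient forces distinct images.
push-injective : ∀ I (g : Fin n → Fin m) σ → push I g σ ≢ 0ℚ → ∀ {i j} → i ∈ I → j ∈ I → g i ≡ g j → i ≡ j
push-injective (outside ∷ I) g σ p≢0 (there i∈I) (there j∈I) eq = cong suc (push-injective I (g ∘ suc) σ p≢0 i∈I j∈I eq)
push-injective (inside  ∷ I) g σ p≢0 {i} {j} i∈I′ j∈I′ eq = go i∈I′ j∈I′ eq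
  where
  q≢0 = proj₂ (δ⁅⁆-support (g zero) _ σ p≢0)
  fresh : ∀ {k} → k ∈ I → g (suc k) ≢ g zero
  fresh k∈I = proj₂ (∈-remove⁻ σ (g zero) (push-∈⁺ I (g ∘ suc) _ q≢0 k∈I))
  go : ∀ {i j} → i ∈ inside ∷ I → j ∈ inside ∷ I → g i ≡ g j → i ≡ j
  go here        here        _  = refl
  go here        (there j∈I) eq = contradiction (sym eq) (fresh j∈I)
  go (there i∈I) here        eq = contradiction eq (fresh i∈I)
  go (there i∈I) (there j∈I) eq = cong suc (push-injective I (g ∘ suc) _ q≢0 i∈I j∈I eq)

-- Induction on `n`, with `M₀` the block of sets avoiding the first element. The commutation rule at
-- row `⊤` and column `outside ∷ ⊤` has one surviving term on each side, so the corner of `M` is `a`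
-- times the corner of `M₀`.
triangular⇒≢0 : ∀ {a} → a ≢ 0ℚ → (M : Subset n → Subset n → ℚ) →
  (∀ I J → ¬ J ⊆ I → M I J ≡ 0ℚ) →
  (∀ I J → ∂ ⊤ (M I) J ≡ a * δ ⊤ (λ I → M I J) I) →
  M ⊥ ⊥ ≢ 0ℚ → M ⊤ ⊤ ≢ 0ℚ
triangular⇒≢0 {zero}      a≢0 M tri comm M⊥≢0 = M⊥≢0
triangular⇒≢0 {suc n} {a} a≢0 M tri comm M⊥≢0 M⊤≡0 = *-nonzero a≢0 M₀⊤≢0 (begin
  a * M₀ ⊤ ⊤
    ≡⟨ cong (a *_) (solve 1 (λ x → x := con 1ℚ :* x :- con 0ℚ) refl (M₀ ⊤ ⊤)) ⟩
  a * (1ℚ * M₀ ⊤ ⊤ - 0ℚ)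
    ≡⟨ cong (λ x → a * (1ℚ * M₀ ⊤ ⊤ - x)) (sym δ≡0) ⟩
  a * (1ℚ * M₀ ⊤ ⊤ - δ ⊤ (λ I → M (inside ∷ I) (outside ∷ ⊤)) ⊤)
    ≡⟨ sym (comm ⊤ (outside ∷ ⊤)) ⟩
  1ℚ * M ⊤ ⊤ + ∂ ⊤ (λ J → M ⊤ (outside ∷ J)) ⊤
    ≡⟨ cong₂ (λ x y → 1ℚ * x + y) M⊤≡0 (∂-vanish {n} ⊤ (λ J → M ⊤ (outside ∷ J)) ⊤ λ w w∉⊤ → contradiction ∈⊤ w∉⊤) ⟩
  0ℚ ∎)
  where
  open ≡-Reasoning
  M₀ : Subset n → Subset n → ℚ
  M₀ I J = M (outside ∷ I) (outside ∷ J)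

  M₀-comm : ∀ I J → ∂ ⊤ (M₀ I) J ≡ a * δ ⊤ (λ I → M₀ I J) I
  M₀-comm I J = begin
    ∂ ⊤ (M₀ I) J
      ≡⟨ solve 1 (λ x → x := con 1ℚ :* con 0ℚ :+ x) refl (∂ ⊤ (M₀ I) J) ⟩
    1ℚ * 0ℚ + ∂ ⊤ (M₀ I) J
      ≡⟨ cong (λ x → 1ℚ * x + ∂ ⊤ (M₀ I) J) (sym (tri (outside ∷ I) (inside ∷ J) λ sub → case sub here of λ ())) ⟩
    1ℚ * M (outside ∷ I) (inside ∷ J) + ∂ ⊤ (M₀ I) J    ≡⟨ comm (outside ∷ I) (outside ∷ J) ⟩
    a * δ ⊤ (λ I → M₀ I J) I                            ∎

  M₀⊤≢0 : M₀ ⊤ ⊤ ≢ 0ℚ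
  M₀⊤≢0 = triangular⇒≢0 a≢0 M₀ (λ I J J⊈I → tri _ _ (λ sub → J⊈I (drop-∷-⊆ sub))) M₀-comm M⊥≢0

  δ≡0 : δ ⊤ (λ I → M (inside ∷ I) (outside ∷ ⊤)) ⊤ ≡ 0ℚ
  δ≡0 = δ-vanish ⊤ _ ⊤ λ w _ → trans
    (cong (χ (lookup ⊤ w) *_) (tri _ _ λ sub → proj₂ (∈-remove⁻ ⊤ w (drop-there (sub (there ∈⊤)))) refl))
    (ℚ.*-zeroʳ (χ (lookup ⊤ w)))

module Colouring (colour : Fin m → Fin n) where

  -- The transpose of the chain map of `colour`. In particular `Φ ⊤` is the signed indicator of the
  -- sets containing each colour exactly once.
  Φ : Subset n → Chain m
  Φ J σ = push σ colour J

  Φ-∈⁻ : ∀ {J σ} → Φ J σ ≢ 0ℚ → ∀ {j} → j ∈ J → ∃ λ e → e ∈ σ × colour e ≡ j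
  Φ-∈⁻ {J} {σ} = push-∈⁻ σ colour J

  -- Transposed, this is the coefficient of `⊤` in a boundary of colour sets, and `⊤` is a facet of
  -- nothing.
  δ-Φ : ∀ σ → δ ⊤ (Φ ⊤) σ ≡ 0ℚ
  δ-Φ σ = trans (sym (∂-push σ colour ⊤)) (∂-vanish ⊤ (push σ colour) ⊤ λ w w∉⊤ → contradiction ∈⊤ w∉⊤)

  -- The pairings form the matrix of `H` followed by the colour map. It is triangular because `H I`
  -- uses only colours in `I`, and it commutes with boundaries up to `a`, so its top corner is
  -- nonzero.
  ⟨Φ,⟩≢0 : ∀ {a} → a ≢ 0ℚ → (H : Subset n → Chain m) →
    (∀ I σ → H I σ ≢ 0ℚ → ∀ {e} → e ∈ σ → colour e ∈ I) →
    (∀ I σ → ∂ ⊤ (H I) σ ≡ a * δ ⊤ (λ J → H J σ) I) →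
    H ⊥ ≗ basis ⊥ → ⟨ Φ ⊤ , H ⊤ ⟩ ≢ 0ℚ
  ⟨Φ,⟩≢0 {a} a≢0 H H-colour ∂H H⊥ = triangular⇒≢0 a≢0 (λ I J → ⟨ Φ J , H I ⟩) tri comm
    (λ eq → case trans (sym base) eq of λ ())
    where
    open ≡-Reasoning
    tri : ∀ I J → ¬ J ⊆ I → ⟨ Φ J , H I ⟩ ≡ 0ℚ
    tri I J J⊈I = ℓ-vanish ∑-linear λ σ → *≡0ˡ λ H≢0 →
      support⇒supported {f = λ σ → Φ J σ} {P = λ σ → H I σ ≢ 0ℚ → J ⊆ I}
        (λ σ Φ≢0 H≢0 {j} j∈J → let e , e∈σ , ce≡j = Φ-∈⁻ Φ≢0 j∈J in subst (_∈ I) ce≡j (H-colour I σ H≢0 e∈σ))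
        σ (λ imp → J⊈I (imp H≢0))

    comm : ∀ I J → ∂ ⊤ (λ J → ⟨ Φ J , H I ⟩) J ≡ a * δ ⊤ (λ I → ⟨ Φ J , H I ⟩) I
    comm I J = begin
      ∂ ⊤ (λ J → ⟨ Φ J , H I ⟩) J                    ≡⟨ ∂-linear ⊤ J .ℓ-cong (λ J → ⟨,⟩-comm (Φ J) (H I)) ⟩
      ∂ ⊤ (λ J → ⟨ H I , Φ J ⟩) J                    ≡⟨ sym (∂-commute (⟨,⟩-linear (H I)) ⊤ Φ J) ⟩
      ⟨ H I , (λ σ → ∂ ⊤ (push σ colour) J) ⟩        ≡⟨ ⟨,⟩-linear (H I) .ℓ-cong (λ σ → ∂-push σ colour J) ⟩
      ⟨ H I , δ ⊤ (Φ J) ⟩                            ≡⟨ sym (adjoint ⊤ (H I) (Φ J)) ⟩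
      ⟨ ∂ ⊤ (H I) , Φ J ⟩                            ≡⟨ ⟨,⟩-comm (∂ ⊤ (H I)) (Φ J) ⟩
      ⟨ Φ J , ∂ ⊤ (H I) ⟩                            ≡⟨ ⟨,⟩-linear (Φ J) .ℓ-cong (∂H I) ⟩
      ⟨ Φ J , (λ σ → a * δ ⊤ (λ J → H J σ) I) ⟩      ≡⟨ ℓ-scale (⟨,⟩-linear (Φ J)) a _ ⟩
      a * ⟨ Φ J , (λ σ → δ ⊤ (λ J → H J σ) I) ⟩      ≡⟨ cong (a *_) (δ-commute (⟨,⟩-linear (Φ J)) ⊤ H I) ⟩
      a * δ ⊤ (λ I → ⟨ Φ J , H I ⟩) I                ∎

    base : ⟨ Φ ⊥ , H ⊥ ⟩ ≡ 1ℚ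
    base = begin
      ⟨ Φ ⊥ , H ⊥ ⟩      ≡⟨ ⟨,⟩-linear (Φ ⊥) .ℓ-cong H⊥ ⟩
      ⟨ Φ ⊥ , basis ⊥ ⟩  ≡⟨ ⟨,basis⟩ (Φ ⊥) ⊥ ⟩
      push ⊥ colour ⊥    ≡⟨ cong (λ f → f ⊥) (push-⊥ colour) ⟩
      basis {n} ⊥ ⊥      ≡⟨ basis-⊥-⊥ n ⟩
      1ℚ                 ∎

-- Floyd–Warshall: Path xs s t asks for a walk with all inner vertices in xs.
module Reachability {A : Set} (_≟ᴬ_ : DecidableEquality A) {R : Rel A 0ℓ} (R? : Decidable₂ R) where

  Path : List A → Rel A 0ℓ
  Path []       s t = s ≡ t ⊎ R s t
  Path (x ∷ xs) s t = Path xs s t ⊎ (Path xs s x × Path xs x t)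

  path? : ∀ xs → Decidable₂ (Path xs)
  path? []       s t = (s ≟ᴬ t) ⊎-dec R? s t
  path? (x ∷ xs) s t = path? xs s t ⊎-dec (path? xs s x ×-dec path? xs x t)

  path⇒star : ∀ xs {s t} → Path xs s t → Star R s t
  path⇒star []       (inj₁ refl)    = ε
  path⇒star []       (inj₂ Rst)     = Rst ◅ ε
  path⇒star (x ∷ xs) (inj₁ p)       = path⇒star xs p
  path⇒star (x ∷ xs) (inj₂ (p , q)) = path⇒star xs p ◅◅ path⇒star xs q

  edge⇒path : ∀ xs {s t} → s ≡ t ⊎ R s t → Path xs s t
  edge⇒path []       e = e
  edge⇒path (x ∷ xs) e = inj₁ (edge⇒path xs e)

  -- At the position of `x` in the list, each path is cut so that it meets `x` only at its end or
  -- start. When both paths pass through an earlier list element, the loop between the two visits is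
  -- dropped.
  path-trans : ∀ {xs x s t} → x ∈ˡ xs → Path xs s x → Path xs x t → Path xs s t
  path-trans (Any.here refl) p q = inj₂ (start p , end q)
    where
    start : ∀ {x xs s} → Path (x ∷ xs) s x → Path xs s x
    start (inj₁ p)       = p
    start (inj₂ (p , _)) = p
    end : ∀ {x xs t} → Path (x ∷ xs) x t → Path xs x t
    end (inj₁ q)       = q
    end (inj₂ (_ , q)) = q
  path-trans (Any.there x∈) (inj₁ p)        (inj₁ q)        = inj₁ (path-trans x∈ p q)
  path-trans (Any.there x∈) (inj₁ p)        (inj₂ (q , q′)) = inj₂ (path-trans x∈ p q , q′)
  path-trans (Any.there x∈) (inj₂ (p , p′)) (inj₁ q)        = inj₂ (p , path-trans x∈ p′ q)
  path-trans (Any.there x∈) (inj₂ (p , _))  (inj₂ (_ , q))  = inj₂ (p , q)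

-- Subsets with exactly one element

∣p∣≡1⇒unique : ∀ {p : Subset m} {x y} → ∣ p ∣ ≡ 1 → x ∈ p → y ∈ p → x ≡ y
∣p∣≡1⇒unique {p = p} {x} {y} ∣p∣≡1 x∈p y∈p with x ≟ᶠ y
... | yes x≡y = x≡y
... | no  x≢y = case trans (sym ∣p∣≡1) (trans (∣remove∣ y∈p) (cong suc (∣remove∣ (∈-remove⁺ x∈p x≢y)))) of λ ()

∣p∣≢0⇒nonempty : ∀ (p : Subset m) → ∣ p ∣ ≢ 0 → Nonempty p
∣p∣≢0⇒nonempty {m} p ∣p∣≢0 with nonempty? p
... | yes ne = ne
... | no  em = contradiction (trans (cong ∣_∣ (Empty-unique em)) (∣⊥∣≡0 m)) ∣p∣≢0

unique⇒∣p∣≡1 : ∀ {p : Subset m} {x} → x ∈ p → (∀ {y} → y ∈ p → y ≡ x) → ∣ p ∣ ≡ 1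
unique⇒∣p∣≡1 {p = p} {x} x∈p unique = trans (cong ∣_∣ (⊆-antisym p⊆ ⊆p)) (∣⁅x⁆∣≡1 x)
  where
  p⊆ : p ⊆ ⁅ x ⁆
  p⊆ y∈p = subst (_∈ ⁅ x ⁆) (sym (unique y∈p)) (x∈⁅x⁆ x)
  ⊆p : ⁅ x ⁆ ⊆ p
  ⊆p y∈ = subst (_∈ p) (sym (x∈⁅y⁆⇒x≡y x y∈)) x∈p

-- Rainbow matchings

module _ {r n : ℕ} (G : Hypergraph) (uniform : Uniform r G) (𝓔 : Partition (#E G) n)
         (large : ∀ i → ∣ part 𝓔 i ∣ ≥ r ℕ.* maxDegree G ℕ.+ 1) where

  open MatchingComplex G

  colour : Fin (#E G) → Fin n
  colour e = proj₁ (cover 𝓔 e)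

  ∈-part : ∀ e → e ∈ part 𝓔 (colour e)
  ∈-part e = proj₂ (cover 𝓔 e)

  part⇒colour : ∀ {e i} → e ∈ part 𝓔 i → colour e ≡ i
  part⇒colour {e} {i} e∈ with colour e ≟ᶠ i
  ... | yes eq = eq
  ... | no neq = contradiction (e , x∈p∩q⁺ (∈-part e , e∈)) (disjoint 𝓔 (colour e) i neq)

  open Colouring colour

  E⟨_⟩ : Subset n → Subset (#E G)
  E⟨_⟩ = ⋃ (part 𝓔)

  ∈-E⁺ : ∀ {I e} → colour e ∈ I → e ∈ E⟨ I ⟩
  ∈-E⁺ {e = e} ce∈I = ∈-⋃⁺ (part 𝓔) ce∈I (∈-part e)

  ∈-E⁻ : ∀ I {e} → e ∈ E⟨ I ⟩ → colour e ∈ I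
  ∈-E⁻ I e∈ = let i , i∈I , e∈i = ∈-⋃⁻ (part 𝓔) I e∈ in subst (_∈ I) (sym (part⇒colour e∈i)) i∈I

  E-mono : ∀ {I J} → I ⊆ J → E⟨ I ⟩ ⊆ E⟨ J ⟩
  E-mono {I} I⊆J e∈ = ∈-E⁺ (I⊆J (∈-E⁻ I e∈))

  -- The size condition of `acyclic` inside the classes of `I`. The `+ 1` of each class gives
  -- strictness, and `suc k` classes pay even for cycles of size `k ℕ.+ 1`, so both shifts `d = 0`
  -- and `d = 1` are covered.
  E-large : ∀ {I k d} → ∣ I ∣ ≡ suc k → d ℕ.≤ 1 → maxDegree G ℕ.* ((k ℕ.+ d) ℕ.* r) ℕ.< ∣ E⟨ I ⟩ ∣
  E-large {I} {k} {d} ∣I∣≡1+k d≤1 = begin-strict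
    maxDegree G ℕ.* ((k ℕ.+ d) ℕ.* r)           ≤⟨ ℕ.*-monoʳ-≤ (maxDegree G) (ℕ.*-monoˡ-≤ r (ℕ.+-monoʳ-≤ k d≤1)) ⟩
    maxDegree G ℕ.* ((k ℕ.+ 1) ℕ.* r)           ≡⟨ cong (λ x → maxDegree G ℕ.* (x ℕ.* r)) (ℕ.+-comm k 1) ⟩
    maxDegree G ℕ.* (suc k ℕ.* r)               ≡⟨ ℕ.*-comm (maxDegree G) (suc k ℕ.* r) ⟩
    suc k ℕ.* r ℕ.* maxDegree G                 ≡⟨ ℕ.*-assoc (suc k) r (maxDegree G) ⟩
    suc k ℕ.* (r ℕ.* maxDegree G)               <⟨ ℕ.*-monoʳ-< (suc k) (ℕ.m<m+n (r ℕ.* maxDegree G) (s≤s z≤n)) ⟩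
    suc k ℕ.* (r ℕ.* maxDegree G ℕ.+ 1)         ≡⟨ cong (ℕ._* (r ℕ.* maxDegree G ℕ.+ 1)) (sym ∣I∣≡1+k) ⟩
    ∣ I ∣ ℕ.* (r ℕ.* maxDegree G ℕ.+ 1)         ≤⟨ ∣⋃∣≥ (part 𝓔) (disjoint 𝓔) large I ⟩
    ∣ E⟨ I ⟩ ∣                                  ∎
    where open ℕ.≤-Reasoning

  Family : Set
  Family = Subset n → Chain (#E G)

  -- An acyclic-carrier argument: H is built on larger and larger sets of
  -- colours, filling the cycle R I − δ H I inside E⟨ I ⟩.
  module Carrier {d : ℕ} (d≤1 : d ℕ.≤ 1) (R : Family)
    (∂R : ∀ I σ → ∂ ⊤ (R I) σ ≡ δ ⊤ (λ J → R J σ) I)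
    (R-face : ∀ I k → ∣ I ∣ ≡ suc k → R I SupportedOn Face E⟨ I ⟩ (k ℕ.+ d))
    (b : Chain (#E G)) (b-face : b SupportedOn Face E⟨ ⊥ ⟩ d) (∂b : ∂ ⊤ b ≗ R ⊥) where

    -- With `d = 0` and `R` zero, a family of fillings is a chain map up to sign; with `d = 1` it is
    -- a chain homotopy whose total boundary is `R`.
    Filling : Family → Subset n → Chain (#E G) → Set
    Filling H I w = w SupportedOn Face E⟨ I ⟩ (∣ I ∣ ℕ.+ d) × (∀ σ → ∂ ⊤ w σ ≡ R I σ - δ ⊤ (λ J → H J σ) I)

    FilledTo : ℕ → Family → Set
    FilledTo k H = H ⊥ ≗ b × (∀ I → ∣ I ∣ ℕ.≤ k → Filling H I (H I))

    filled-0 : FilledTo 0 (λ _ → b)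
    filled-0 = (λ _ → refl) , λ I ∣I∣≤0 → filled I (⊆-antisym (empty I ∣I∣≤0) ⊥⊆)
      where
      empty : ∀ I → ∣ I ∣ ℕ.≤ 0 → I ⊆ ⊥
      empty I ∣I∣≤0 i∈I = case ℕ.≤-trans (ℕ.≤-reflexive (sym (∣remove∣ i∈I))) ∣I∣≤0 of λ ()
      filled : ∀ I → I ≡ ⊥ → Filling (λ _ → b) I b
      filled I refl = subst (λ k → b SupportedOn Face E⟨ ⊥ ⟩ (k ℕ.+ d)) (sym (∣⊥∣≡0 n)) b-face , λ σ → trans (∂b σ)
        (trans (sym (ℚ.+-identityʳ (R ⊥ σ))) (cong (λ x → R ⊥ σ - x) (sym (δ-vanish {n} ⊤ (λ _ → b σ) ⊥ λ w w∈⊥ → contradiction w∈⊥ ∉⊥))))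

    module _ {k H} (filled : FilledTo k H) where

      ∣remove∣≤ : ∀ {I : Subset n} {w} → ∣ I ∣ ℕ.≤ suc k → w ∈ I → ∣ I [ w ]≔ outside ∣ ℕ.≤ k
      ∣remove∣≤ ∣I∣≤1+k w∈I = ℕ.≤-pred (ℕ.≤-trans (ℕ.≤-reflexive (sym (∣remove∣ w∈I))) ∣I∣≤1+k)

      fill : ∀ I → ∣ I ∣ ≡ suc k → ∃ (Filling H I)
      fill I ∣I∣≡1+k =
        let w , w-face , ∂w = acyclic uniform (E-large {I} ∣I∣≡1+k d≤1) Z-face ∂Z≡0
        in w , subst (λ j → w SupportedOn Face E⟨ I ⟩ (j ℕ.+ d)) (sym ∣I∣≡1+k) w-face , ∂w
        where
        open ≡-Reasoning
        δH : Chain (#E G)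
        δH σ = δ ⊤ (λ J → H J σ) I

        lower : ∀ {w} → w ∈ I → Filling H (I [ w ]≔ outside) (H (I [ w ]≔ outside))
        lower w∈I = proj₂ filled _ (∣remove∣≤ (ℕ.≤-reflexive ∣I∣≡1+k) w∈I)

        δH-face : δH SupportedOn Face E⟨ I ⟩ (k ℕ.+ d)
        δH-face σ ¬face = δ-vanish ⊤ (λ J → H J σ) I λ w w∈I → trans
          (cong (χ (lookup ⊤ w) *_) (proj₁ (lower w∈I) σ λ (face mat ⊆E ≤k) →
            ¬face (face mat (λ x∈ → E-mono (λ i∈ → proj₁ (∈-remove⁻ I w i∈)) (⊆E x∈))
              (ℕ.≤-trans ≤k (ℕ.+-monoˡ-≤ d (∣remove∣≤ (ℕ.≤-reflexive ∣I∣≡1+k) w∈I))))))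
          (ℚ.*-zeroʳ (χ (lookup ⊤ w)))

        Z-face : (λ σ → R I σ - δH σ) SupportedOn Face E⟨ I ⟩ (k ℕ.+ d)
        Z-face σ ¬face = cong₂ _-_ (R-face I k ∣I∣≡1+k σ ¬face) (δH-face σ ¬face)

        -- Facets of `I` are already filled, so their equations turn the boundary of `δH` into `δR`
        -- minus a double coboundary, which vanishes.
        ∂Z≡0 : ∀ σ → ∂ ⊤ (λ σ → R I σ - δH σ) σ ≡ 0ℚ
        ∂Z≡0 σ = begin
          ∂ ⊤ (λ σ → R I σ - δH σ) σ                                      ≡⟨ ℓ-sub (∂-linear ⊤ σ) (R I) δH ⟩
          ∂ ⊤ (R I) σ - ∂ ⊤ δH σ
            ≡⟨ cong₂ _-_ (∂R I σ) (δ-commute (∂-linear ⊤ σ) ⊤ H I) ⟩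
          δR - δ ⊤ (λ J → ∂ ⊤ (H J) σ) I
            ≡⟨ cong (λ x → δR - x) (δ-local ⊤ ⊤ (λ J → ∂ ⊤ (H J) σ) (λ J → R J σ - δ ⊤ (λ K → H K σ) J) I
                                                                               λ w w∈I → cong (χ (lookup ⊤ w) *_) (proj₂ (lower w∈I) σ)) ⟩
          δR - δ ⊤ (λ J → R J σ - δ ⊤ (λ K → H K σ) J) I
            ≡⟨ cong (λ x → δR - x) (ℓ-sub (δ-linear ⊤ I) (λ J → R J σ) (δ ⊤ (λ K → H K σ))) ⟩
          δR - (δR - δ ⊤ (δ ⊤ (λ K → H K σ)) I)
            ≡⟨ cong (λ x → δR - (δR - x)) (δδ≡0 ⊤ (λ K → H K σ) I) ⟩
          δR - (δR - 0ℚ)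
            ≡⟨ solve 1 (λ x → x :- (x :- con 0ℚ) := con 0ℚ) refl δR ⟩
          0ℚ                                                              ∎
          where δR = δ ⊤ (λ J → R J σ) I

      extend : ∀ I → ∃ λ w → (∣ I ∣ ℕ.≤ k → w ≗ H I) × (∣ I ∣ ℕ.≤ suc k → Filling H I w)
      extend I with ∣ I ∣ ℕ.≤? k | ∣ I ∣ ℕ.≟ suc k
      ... | yes ∣I∣≤k | _           = H I , (λ _ _ → refl) , λ _ → proj₂ filled I ∣I∣≤k
      ... | no  ∣I∣≰k | yes ∣I∣≡1+k = let w , w-fill = fill I ∣I∣≡1+k in
                                      w , (λ ∣I∣≤k → contradiction ∣I∣≤k ∣I∣≰k) , λ _ → w-fill
      -- Sets of more than `suc k` colours get a placeholder; both implications are vacuous for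
      -- them.
      ... | no  ∣I∣≰k | no  ∣I∣≢1+k = (λ _ → 0ℚ) , (λ ∣I∣≤k → contradiction ∣I∣≤k ∣I∣≰k)
                                    , λ ∣I∣≤1+k → contradiction (ℕ.≤-antisym ∣I∣≤1+k (ℕ.≰⇒> ∣I∣≰k)) ∣I∣≢1+k

      -- The equation at `I` mentions `H` only at facets, which have at most `k` colours, and there
      -- `extend` changes nothing.
      filled-suc : FilledTo (suc k) (proj₁ ∘ extend)
      filled-suc = (λ σ → trans (proj₁ (proj₂ (extend ⊥)) (ℕ.≤-trans (ℕ.≤-reflexive (∣⊥∣≡0 n)) z≤n) σ) (proj₁ filled σ)) , λ I ∣I∣≤1+k →
        let supported , ∂w = proj₂ (proj₂ (extend I)) ∣I∣≤1+k
        in supported , λ σ → trans (∂w σ) (cong (λ x → R I σ - x) (δ-local ⊤ ⊤ (λ J → H J σ) (λ J → proj₁ (extend J) σ) I λ w w∈I →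
          cong (χ (lookup ⊤ w) *_) (sym (proj₁ (proj₂ (extend (I [ w ]≔ outside))) (∣remove∣≤ ∣I∣≤1+k w∈I) σ))))

    filled-to : ∀ k → ∃ (FilledTo k)
    filled-to zero    = (λ _ → b) , filled-0
    filled-to (suc k) = _ , filled-suc (proj₂ (filled-to k))

    filling : ∃ λ H → H ⊥ ≗ b × (∀ I → Filling H I (H I))
    filling = let H , H⊥ , H-fill = filled-to n in H , H⊥ , λ I → H-fill I (∣p∣≤n I)

  -- Existence of a full rainbow matching

  FullRainbow : Subset (#E G) → Set
  FullRainbow = IsFullRainbow (matchingComplex G) 𝓔

  fullRainbow? : Decidable FullRainbow
  fullRainbow? σ = matching? σ ×-dec all? (λ i → ∣ σ ∩ part 𝓔 i ∣ ℕ.≟ 1)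

  -- A nonzero coefficient of `⊤` makes `colour` surjective from `σ` by `Φ-∈⁻` and injective on it
  -- by `push-injective`.
  Φ≢0⇒fullRainbow : ∀ {σ} → IsMatching G σ → Φ ⊤ σ ≢ 0ℚ → FullRainbow σ
  Φ≢0⇒fullRainbow {σ} mat Φ≢0 = mat , λ i →
    let e , e∈σ , ce≡i = Φ-∈⁻ Φ≢0 ∈⊤
    in unique⇒∣p∣≡1 (x∈p∩q⁺ (e∈σ , subst (λ i → e ∈ part 𝓔 i) ce≡i (∈-part e))) λ {f} f∈ →
      let f∈σ , f∈i = x∈p∩q⁻ σ (part 𝓔 i) f∈
      in push-injective σ colour ⊤ Φ≢0 f∈σ e∈σ (trans (part⇒colour f∈i) (sym ce≡i))

  fullRainbow-exists : ∃ FullRainbow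
  fullRainbow-exists =
    let H , H⊥ , H-fill = filling
        -- Here `R` is zero, so `H` commutes with boundaries up to the factor `a = - 1ℚ`.
        ∂H : ∀ I σ → ∂ ⊤ (H I) σ ≡ - 1ℚ * δ ⊤ (λ J → H J σ) I
        ∂H I σ = trans (proj₂ (H-fill I) σ)
          (solve 1 (λ x → con 0ℚ :- x := con (- 1ℚ) :* x) refl (δ ⊤ (λ J → H J σ) I))

        -- A nonzero pairing has a nonzero term: its `σ` is a matching by the support of `H ⊤` and
        -- rainbow by `Φ ⊤`.
        σ , ΦH≢0 = ∑≢0⇒∃≢0 _ (⟨Φ,⟩≢0 { - 1ℚ} (λ ()) H
          (λ I σ H≢0 e∈σ → ∈-E⁻ I (Face.within (faceOf (proj₁ (H-fill I)) H≢0) e∈σ)) ∂H H⊥)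
    in σ , Φ≢0⇒fullRainbow (Face.matching (faceOf (proj₁ (H-fill ⊤)) (*≢0ʳ {Φ ⊤ σ} ΦH≢0))) (*≢0ˡ {y = H ⊤ σ} ΦH≢0)
    where
    faceOf : ∀ {A k f σ} → f SupportedOn Face A k → f σ ≢ 0ℚ → Face A k σ
    faceOf {A} {k} {σ = σ} f-face f≢0 with face? A k σ
    ... | yes σ-face = σ-face
    ... | no  ¬face  = contradiction (f-face σ ¬face) f≢0

    ⊥-face : ∀ {σ} → σ ≡ ⊥ → Face E⟨ ⊥ ⟩ 0 σ
    ⊥-face refl = face (∅-simplex (matchingComplex G)) ⊥⊆ (ℕ.≤-reflexive (∣⊥∣≡0 (#E G)))

    open Carrier {0} z≤n (λ _ _ → 0ℚ)
      (λ I σ → trans (ℓ-zero (∂-linear ⊤ σ)) (sym (ℓ-zero (δ-linear ⊤ I)))) (λ _ _ _ _ _ → refl)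
      (basis ⊥) (support⇒supported λ σ b≢0 → ⊥-face (basis-support ⊥ σ b≢0)) ∂-basis-⊥

  -- The chain map of a full rainbow matching

  module Transversal {s} (s-full : FullRainbow s) where

    pick : ∀ i → Nonempty (s ∩ part 𝓔 i)
    pick i = ∣p∣≢0⇒nonempty _ λ ∣p∣≡0 → case trans (sym (proj₂ s-full i)) ∣p∣≡0 of λ ()

    rep : Fin n → Fin (#E G)
    rep i = proj₁ (pick i)

    rep-∈ : ∀ i → rep i ∈ s
    rep-∈ i = proj₁ (x∈p∩q⁻ s (part 𝓔 i) (proj₂ (pick i)))

    colour-rep : ∀ i → colour (rep i) ≡ i
    colour-rep i = part⇒colour (proj₂ (x∈p∩q⁻ s (part 𝓔 i) (proj₂ (pick i))))

    rep-colour : ∀ {e} → e ∈ s → rep (colour e) ≡ e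
    rep-colour {e} e∈s = ∣p∣≡1⇒unique (proj₂ s-full (colour e)) (proj₂ (pick (colour e))) (x∈p∩q⁺ (e∈s , ∈-part e))

    -- The chain map of `rep`, the section of `colour` with image `s`; at `⊤` it is concentrated on
    -- `s` itself.
    S : Family
    S I = push I rep

    S-⊆ : ∀ {I σ} → S I σ ≢ 0ℚ → σ ⊆ s
    S-⊆ {I} {σ} S≢0 x∈σ = let i , _ , eq = push-∈⁻ I rep σ S≢0 x∈σ in subst (_∈ s) eq (rep-∈ i)

    S-colour : ∀ I σ → S I σ ≢ 0ℚ → ∀ {e} → e ∈ σ → colour e ∈ I
    S-colour I σ S≢0 e∈σ =
      let i , i∈I , eq = push-∈⁻ I rep σ S≢0 e∈σ in subst (_∈ I) (trans (sym (colour-rep i)) (cong colour eq)) i∈I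

    -- The sets involved have size `∣ I ∣`, that is `k ℕ.+ 1`; this is the source of the shift
    -- `d = 1` in the homotopy.
    S-face : ∀ I k → ∣ I ∣ ≡ suc k → S I SupportedOn Face E⟨ I ⟩ (k ℕ.+ 1)
    S-face I k ∣I∣≡1+k = support⇒supported λ σ S≢0 →
      face (matching-⊆ (S-⊆ {I} S≢0) (proj₁ s-full)) (λ e∈σ → ∈-E⁺ (S-colour I σ S≢0 e∈σ))
        (ℕ.≤-reflexive (trans (∣push∣ I rep σ S≢0) (trans ∣I∣≡1+k (ℕ.+-comm 1 k))))

    S⊤-support : ∀ {σ} → S ⊤ σ ≢ 0ℚ → σ ≡ s
    S⊤-support {σ} S≢0 = ⊆-antisym (S-⊆ {⊤} S≢0) λ e∈s → subst (_∈ σ) (rep-colour e∈s) (push-∈⁺ ⊤ rep σ S≢0 ∈⊤)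

    ⟨Φ,S⟩≢0 : ⟨ Φ ⊤ , S ⊤ ⟩ ≢ 0ℚ
    ⟨Φ,S⟩≢0 = ⟨Φ,⟩≢0 {1ℚ} (λ ()) S S-colour (λ I σ → trans (∂-push I rep σ) (sym (ℚ.*-identityˡ (δ ⊤ (λ J → S J σ) I))))
      (λ σ → cong (λ f → f σ) (push-⊥ rep))

  -- Adjacency on bare subsets, with fullness as part of the relation: subsets can be listed and
  -- compared, as the path search requires.
  Exchange : Rel (Subset (#E G)) 0ℓ
  Exchange σ τ = FullRainbow σ × FullRainbow τ × IsMatching G (σ ∪ τ) × ∣ σ ∪ τ ∣ ≡ suc n

  exchange? : Decidable₂ Exchange
  exchange? σ τ = fullRainbow? σ ×-dec fullRainbow? τ ×-dec matching? (σ ∪ τ) ×-dec (∣ σ ∪ τ ∣ ℕ.≟ suc n)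

  remove-∪-remove : ∀ {ρ : Subset (#E G)} {u v} → u ≢ v → (ρ [ u ]≔ outside) ∪ (ρ [ v ]≔ outside) ≡ ρ
  remove-∪-remove {ρ} {u} {v} u≢v = ⊆-antisym to from
    where
    to : (ρ [ u ]≔ outside) ∪ (ρ [ v ]≔ outside) ⊆ ρ
    to x∈ with x∈p∪q⁻ (ρ [ u ]≔ outside) (ρ [ v ]≔ outside) x∈
    ... | inj₁ x∈ = proj₁ (∈-remove⁻ ρ u x∈)
    ... | inj₂ x∈ = proj₁ (∈-remove⁻ ρ v x∈)
    from : ρ ⊆ (ρ [ u ]≔ outside) ∪ (ρ [ v ]≔ outside)
    from {x} x∈ρ with x ≟ᶠ u
    ... | yes refl = x∈p∪q⁺ (inj₂ (∈-remove⁺ x∈ρ u≢v))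
    ... | no  x≢u  = x∈p∪q⁺ (inj₁ (∈-remove⁺ x∈ρ x≢u))

  -- Two distinct facets of `ρ` have union `ρ`. A facet on which `Φ ⊤` is nonzero has `n` elements,
  -- so `ρ` has `suc n`.
  facets-exchange : ∀ {ρ u v} → IsMatching G ρ → u ∈ ρ → v ∈ ρ → u ≢ v →
    Φ ⊤ (ρ [ u ]≔ outside) ≢ 0ℚ → Φ ⊤ (ρ [ v ]≔ outside) ≢ 0ℚ →
    Exchange (ρ [ u ]≔ outside) (ρ [ v ]≔ outside)
  facets-exchange {ρ} {u} {v} mat u∈ρ v∈ρ u≢v Φu≢0 Φv≢0 =
      Φ≢0⇒fullRainbow (matching-⊆ (λ x∈ → proj₁ (∈-remove⁻ ρ u x∈)) mat) Φu≢0
    , Φ≢0⇒fullRainbow (matching-⊆ (λ x∈ → proj₁ (∈-remove⁻ ρ v x∈)) mat) Φv≢0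
    , subst (IsMatching G) (sym (remove-∪-remove u≢v)) mat
    , (begin
      ∣ (ρ [ u ]≔ outside) ∪ (ρ [ v ]≔ outside) ∣  ≡⟨ cong ∣_∣ (remove-∪-remove {ρ} u≢v) ⟩
      ∣ ρ ∣                                        ≡⟨ ∣remove∣ u∈ρ ⟩
      suc ∣ ρ [ u ]≔ outside ∣                     ≡⟨ cong suc (sym (∣push∣ (ρ [ u ]≔ outside) colour ⊤ Φu≢0)) ⟩
      suc ∣ ⊤ {n} ∣                                ≡⟨ cong suc (∣⊤∣≡n n) ⟩
      suc n                                        ∎)
    where open ≡-Reasoning

  -- The component of a full rainbow matching and its cocycle

  module Component (s : Subset (#E G)) where

    open Reachability (≡-dec Bool._≟_) exchange?

    Reachable : Subset (#E G) → Set
    Reachable = Path (subsets (#E G)) s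

    reachable? : Decidable Reachable
    reachable? = path? (subsets (#E G)) s

    φ : Chain (#E G)
    φ σ with reachable? σ
    ... | yes _ = Φ ⊤ σ
    ... | no  _ = 0ℚ

    φ-reachable : ∀ {σ} → Reachable σ → φ σ ≡ Φ ⊤ σ
    φ-reachable {σ} reach with reachable? σ
    ... | yes _     = refl
    ... | no ¬reach = contradiction reach ¬reach

    φ-unreachable : ∀ {σ} → ¬ Reachable σ → φ σ ≡ 0ℚ
    φ-unreachable {σ} ¬reach with reachable? σ
    ... | yes reach = contradiction reach ¬reach
    ... | no _      = refl

    φ≢0⇒Φ≢0 : ∀ {σ} → φ σ ≢ 0ℚ → Φ ⊤ σ ≢ 0ℚ
    φ≢0⇒Φ≢0 {σ} φ≢0 with reachable? σ
    ... | yes _ = φ≢0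
    ... | no  _ = contradiction refl φ≢0

    φ≢0⇒reachable : ∀ {σ} → φ σ ≢ 0ℚ → Reachable σ
    φ≢0⇒reachable {σ} φ≢0 with reachable? σ
    ... | yes reach = reach
    ... | no  _     = contradiction refl φ≢0

    -- The full rainbow facets of a matching ρ are pairwise exchangeable,
    -- hence on the facets of ρ the chain φ is either Φ ⊤ or zero.
    δφ≡0 : ∀ {ρ} → IsMatching G ρ → δ ⊤ φ ρ ≡ 0ℚ
    δφ≡0 {ρ} mat with any? (λ w → (w ∈? ρ) ×-dec ¬? (φ (ρ [ w ]≔ outside) ≟ 0ℚ))
    ... | no none = δ-vanish ⊤ φ ρ vanish
      where
      vanish : ∀ w → w ∈ ρ → χ (lookup ⊤ w) * φ (ρ [ w ]≔ outside) ≡ 0ℚ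
      vanish w w∈ρ with φ (ρ [ w ]≔ outside) ≟ 0ℚ
      ... | yes φ≡0 = trans (cong (χ (lookup ⊤ w) *_) φ≡0) (ℚ.*-zeroʳ (χ (lookup ⊤ w)))
      ... | no  φ≢0 = contradiction (w , w∈ρ , φ≢0) none
    ... | yes (u , u∈ρ , φ≢0) = trans (δ-local ⊤ ⊤ φ (Φ ⊤) ρ λ w w∈ρ → cong (χ (lookup ⊤ w) *_) (agree w w∈ρ)) (δ-Φ ρ)
      where
      agree : ∀ w → w ∈ ρ → φ (ρ [ w ]≔ outside) ≡ Φ ⊤ (ρ [ w ]≔ outside)
      agree w w∈ρ with w ≟ᶠ u | Φ ⊤ (ρ [ w ]≔ outside) ≟ 0ℚ
      ... | yes refl | _       = φ-reachable (φ≢0⇒reachable φ≢0)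
      ... | no  w≢u  | no Φ≢0  = φ-reachable (path-trans (∈-subsets _) (φ≢0⇒reachable φ≢0)
              (edge⇒path (subsets (#E G)) (inj₂ (facets-exchange mat u∈ρ w∈ρ (w≢u ∘ sym) (φ≢0⇒Φ≢0 φ≢0) Φ≢0))))
      ... | no  _    | yes Φ≡0 with φ (ρ [ w ]≔ outside) ≟ 0ℚ
      ...   | yes φ≡0  = trans φ≡0 (sym Φ≡0)
      ...   | no  φ≢0′ = contradiction Φ≡0 (φ≢0⇒Φ≢0 φ≢0′)

    module _ (s-full : FullRainbow s) {t : Subset (#E G)} (t-full : FullRainbow t) where

      module 𝐒 = Transversal s-full
      module 𝐓 = Transversal t-full

      R : Family
      R I σ = 𝐒.S I σ - 𝐓.S I σ

      -- Both chain maps send the empty set to `basis ⊥`, so the homotopy may start from zero.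
      R⊥≡0 : ∀ σ → R ⊥ σ ≡ 0ℚ
      R⊥≡0 σ = trans (cong₂ (λ f g → f σ - g σ) (push-⊥ 𝐒.rep) (push-⊥ 𝐓.rep)) (ℚ.+-inverseʳ (basis ⊥ σ))

      open Carrier {1} ℕ.≤-refl R
        (λ I σ → trans (ℓ-sub (∂-linear ⊤ σ) (𝐒.S I) (𝐓.S I))
          (trans (cong₂ _-_ (∂-push I 𝐒.rep σ) (∂-push I 𝐓.rep σ)) (sym (ℓ-sub (δ-linear ⊤ I) (λ J → 𝐒.S J σ) (λ J → 𝐓.S J σ)))))
        (λ I k ∣I∣≡1+k σ ¬face → cong₂ _-_ (𝐒.S-face I k ∣I∣≡1+k σ ¬face) (𝐓.S-face I k ∣I∣≡1+k σ ¬face))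
        (λ _ → 0ℚ) (λ _ _ → refl) (λ σ → trans (ℓ-zero (∂-linear ⊤ σ)) (sym (R⊥≡0 σ)))

      -- `R ⊤` is the boundary of `H ⊤` plus `δH`. The first pairs to zero because `φ` is a cocycle
      -- on matchings; the second because each of its terms misses a colour, while `φ` lives on sets
      -- with every colour.
      ⟨φ,R⟩≡0 : ⟨ φ , R ⊤ ⟩ ≡ 0ℚ
      ⟨φ,R⟩≡0 = begin
        ⟨ φ , R ⊤ ⟩
          ≡⟨ solve 2 (λ x y → x := (x :- y) :+ y) refl ⟨ φ , R ⊤ ⟩ ⟨ φ , δH ⟩ ⟩
        (⟨ φ , R ⊤ ⟩ - ⟨ φ , δH ⟩) + ⟨ φ , δH ⟩
          ≡⟨ cong (_+ ⟨ φ , δH ⟩) (sym (ℓ-sub (⟨,⟩-linear φ) (R ⊤) δH)) ⟩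
        ⟨ φ , (λ σ → R ⊤ σ - δH σ) ⟩ + ⟨ φ , δH ⟩
          ≡⟨ cong₂ _+_ (⟨,⟩-linear φ .ℓ-cong (λ σ → sym (proj₂ (H-fill ⊤) σ))) φδH≡0 ⟩
        ⟨ φ , ∂ ⊤ (H ⊤) ⟩ + 0ℚ                           ≡⟨ ℚ.+-identityʳ ⟨ φ , ∂ ⊤ (H ⊤) ⟩ ⟩
        ⟨ φ , ∂ ⊤ (H ⊤) ⟩                                ≡⟨ ⟨,⟩-comm φ (∂ ⊤ (H ⊤)) ⟩
        ⟨ ∂ ⊤ (H ⊤) , φ ⟩                                ≡⟨ adjoint ⊤ (H ⊤) φ ⟩
        ⟨ H ⊤ , δ ⊤ φ ⟩                                  ≡⟨ ℓ-vanish ∑-linear (λ σ → *≡0ˡ λ δφ≢0 →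
                                                              proj₁ (H-fill ⊤) σ λ σ-face → δφ≢0 (δφ≡0 (Face.matching σ-face))) ⟩
        0ℚ                                               ∎
        where
        open ≡-Reasoning
        H = proj₁ filling
        H-fill = proj₂ (proj₂ filling)
        δH : Chain (#E G)
        δH σ = δ ⊤ (λ J → H J σ) ⊤

        φδH≡0 : ⟨ φ , δH ⟩ ≡ 0ℚ
        φδH≡0 = ℓ-vanish ∑-linear λ σ → trans (ℚ.*-comm (φ σ) (δH σ)) (*≡0ˡ λ φ≢0 → δ-vanish ⊤ (λ J → H J σ) ⊤ λ w _ → trans
          (cong (χ (lookup ⊤ w) *_) (proj₁ (H-fill _) σ λ σ-face →
            let e , e∈σ , ce≡w = Φ-∈⁻ {⊤} (φ≢0⇒Φ≢0 φ≢0) (∈⊤ {x = w})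
            in proj₂ (∈-remove⁻ ⊤ w (∈-E⁻ _ (Face.within σ-face e∈σ))) ce≡w))
          (ℚ.*-zeroʳ (χ (lookup ⊤ w))))

      -- Otherwise `φ` vanishes at `t` and agrees with `Φ ⊤` at `s`, so its pairing with `R ⊤` would
      -- be the nonzero number `⟨ Φ ⊤ , 𝐒.S ⊤ ⟩`.
      reachable : Reachable t
      reachable with reachable? t
      ... | yes reach = reach
      ... | no ¬reach = contradiction (begin
        ⟨ Φ ⊤ , 𝐒.S ⊤ ⟩                ≡⟨ ∑-linear .ℓ-cong on-s ⟩
        ⟨ φ , 𝐒.S ⊤ ⟩                  ≡⟨ solve 1 (λ x → x := x :- con 0ℚ) refl ⟨ φ , 𝐒.S ⊤ ⟩ ⟩
        ⟨ φ , 𝐒.S ⊤ ⟩ - 0ℚ             ≡⟨ cong (λ x → ⟨ φ , 𝐒.S ⊤ ⟩ - x) (sym off-t) ⟩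
        ⟨ φ , 𝐒.S ⊤ ⟩ - ⟨ φ , 𝐓.S ⊤ ⟩  ≡⟨ sym (ℓ-sub (⟨,⟩-linear φ) (𝐒.S ⊤) (𝐓.S ⊤)) ⟩
        ⟨ φ , R ⊤ ⟩                    ≡⟨ ⟨φ,R⟩≡0 ⟩
        0ℚ                             ∎) 𝐒.⟨Φ,S⟩≢0
        where
        open ≡-Reasoning
        on-s : ∀ σ → Φ ⊤ σ * 𝐒.S ⊤ σ ≡ φ σ * 𝐒.S ⊤ σ
        on-s σ with 𝐒.S ⊤ σ ≟ 0ℚ
        ... | yes S≡0 =
            trans (cong (Φ ⊤ σ *_) S≡0) (trans (trans (ℚ.*-zeroʳ (Φ ⊤ σ)) (sym (ℚ.*-zeroʳ (φ σ)))) (cong (φ σ *_) (sym S≡0)))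
        ... | no  S≢0 = cong (_* 𝐒.S ⊤ σ) (sym (φ-reachable (edge⇒path (subsets (#E G)) (inj₁ (sym (𝐒.S⊤-support S≢0))))))
        off-t : ⟨ φ , 𝐓.S ⊤ ⟩ ≡ 0ℚ
        off-t =
          ℓ-vanish (∑-linear {#E G}) λ σ → *≡0ˡ {φ σ} {𝐓.S ⊤ σ} λ T≢0 → φ-unreachable (λ reach → ¬reach (subst Reachable (𝐓.S⊤-support T≢0) reach))

      walk : Star Exchange s t
      walk = path⇒star (subsets (#E G)) reachable

  -- From exchange walks to connectedness

  open Graph (RG (matchingComplex G) 𝓔)

  lift-walk : ∀ {σ τ} → Star Exchange σ τ → .(σ-full : FullRainbow σ) .(τ-full : FullRainbow τ) →
              Star Adjacent (σ Refinement., [ σ-full ]) (τ Refinement., [ τ-full ])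
  lift-walk ε                                  _ _      = ε
  lift-walk ((_ , υ-full , mat , size) ◅ rest) _ τ-full = (mat , size) ◅ lift-walk rest υ-full τ-full

  RG-connected : Connected (RG (matchingComplex G) 𝓔)
  RG-connected =
      (let σ , σ-full = fullRainbow-exists in σ Refinement., [ σ-full ])
    , λ { (s Refinement., [ s-full ]) (t Refinement., [ t-full ]) →
          -- Vertices store fullness irrelevantly; since it is decidable, `recompute` recovers the
          -- proofs that the homological argument inspects.
          lift-walk (Component.walk s (recompute (fullRainbow? s) s-full) (recompute (fullRainbow? t) t-full)) s-full t-full }

theorem6p6 : (r n : ℕ) (G : Hypergraph) → Uniform r G →
    (𝓔 : Partition (#E G) n) →
    (∀ i → ∣ part 𝓔 i ∣ ≥ r ℕ.* maxDegree G ℕ.+ 1) →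
    Connected (RG (matchingComplex G) 𝓔)
theorem6p6 r n G uniform 𝓔 large = RG-connected G uniform 𝓔 large
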